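{- For any $a,b,c\in\mathbb{N}_0$, $$t^{\star}(\{2\}^{a},3,\{2\}^{b},1,\{2\}^{c})=-\frac{4}{\pi}t(\overline{2a+2b+2c+5})-\frac{8}{\pi}t(\overline{2a+2},2b+2c+3)-\frac{8}{\pi}t(2a+2b+4,\overline{2c+1})-\frac{16}{\pi}t(\overline{2a+2},\overline{2b+2},\overline{2c+1})$$ and $$t^{\star}(\{2\}^{a},3,\{2\}^{b},3,\{2\}^{c})=-\frac{4}{\pi}t(\overline{2a+2b+2c+7})-\frac{8}{\pi}t(\overline{2a+2},2b+2c+5)-\frac{8}{\pi}t(\overline{2a+2b+5},2c+2)-\frac{16}{\pi}t(\overline{2a+2},2b+3,2c+2).$$
   Context: $t^{\star}(\boldsymbol{s})=\sum_{k_1\geq\cdots\geq k_r\geq1}\prod_{j}(2k_j-1)^{ -s_j}$ for an index with $s_1>1$; $\{2\}^a$ is $2$ repeated $a$ times. Alternating multiple $t$-values: $t(\boldsymbol{s};\boldsymbol{\sigma})=\sum_{k_1>\cdots>k_r\geq1}\prod_{j}\frac{\sigma_j^{k_j}}{(2k_j-1)^{s_j}}$, where a bar over $s_j$ means $\sigma_j=-1$ and no bar means $\sigma_j=1$. -}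

module Defs where

open import Data.Nat as ℕ using (ℕ; zero; suc; z≤n; s≤s)
import Data.Nat.Properties as ℕ
open import Data.Nat.Tactic.RingSolver using (solve-∀)
open import Data.Integer as ℤ using (ℤ; +_; -[1+_]; 1ℤ; -1ℤ)
import Data.Integer.Properties as ℤ
open import Data.Rational
open import Data.Rational.Properties
import Data.Rational.Unnormalised as ℚᵘ
import Data.Rational.Unnormalised.Properties as ℚᵘ
open import Data.Rational.Solver using (module +-*-Solver)
open import Data.List using (List; []; _∷_; _++_; map; replicate)
open import Data.List.Relation.Unary.All as All using (All; []; _∷_; all?)
import Data.List.Relation.Unary.All.Properties as All
open import Data.Product using (Σ; _×_; _,_; proj₁; proj₂)
open import Data.Sum using (_⊎_; inj₁; inj₂)
open import Relation.Nullary using (Dec; yes; no; contradiction)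
open import Relation.Nullary.Decidable using (True; toWitness; map′; _×-dec_)
open import Relation.Binary.PropositionalEquality

module RationalLemmas where

  *-mono-nonNeg : ∀ {p q r s} → 0ℚ ≤ r → 0ℚ ≤ q → p ≤ q → r ≤ s → p * r ≤ q * s
  *-mono-nonNeg {p} {q} {r} {s} 0≤r 0≤q p≤q r≤s = ≤-trans
    (*-monoʳ-≤-nonNeg r {{nonNegative 0≤r}} p≤q)
    (*-monoˡ-≤-nonNeg q {{nonNegative 0≤q}} r≤s)

  *-nonNeg : ∀ {p q} → 0ℚ ≤ p → 0ℚ ≤ q → 0ℚ ≤ p * q
  *-nonNeg {p} {q} 0≤p 0≤q =
    subst (_≤ p * q) (*-zeroˡ q) (*-monoʳ-≤-nonNeg q {{nonNegative 0≤q}} 0≤p)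

  *-pos : ∀ {p q} → 0ℚ < p → 0ℚ < q → 0ℚ < p * q
  *-pos {p} {q} 0<p 0<q =
    subst (_< p * q) (*-zeroˡ q) (*-monoˡ-<-pos q {{positive 0<q}} 0<p)

  +-nonNeg : ∀ {p q} → 0ℚ ≤ p → 0ℚ ≤ q → 0ℚ ≤ p + q
  +-nonNeg 0≤p 0≤q = +-mono-≤ 0≤p 0≤q

  p-q≤p : ∀ p {q} → 0ℚ ≤ q → p - q ≤ p
  p-q≤p p {q} 0≤q = subst (p - q ≤_) (+-identityʳ p) (+-monoʳ-≤ p (neg-antimono-≤ 0≤q))

  p≤q⇒0≤q-p : ∀ {p q} → p ≤ q → 0ℚ ≤ q - p
  p≤q⇒0≤q-p {p} {q} p≤q = subst (_≤ q - p) (+-inverseʳ p) (+-monoˡ-≤ (- p) p≤q)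

  ∣p-q∣≡∣q-p∣ : ∀ p q → ∣ p - q ∣ ≡ ∣ q - p ∣
  ∣p-q∣≡∣q-p∣ p q = trans (sym (∣-p∣≡∣p∣ (p - q))) (cong ∣_∣
    (solve 2 (λ p q → :- (p :- q) := q :- p) refl p q))
    where open +-*-Solver

  0<½*_ : ∀ {ε} → 0ℚ < ε → 0ℚ < ½ * ε
  0<½* 0<ε = *-pos (positive⁻¹ ½) 0<ε

  ½*p+½*p≡p : ∀ p → ½ * p + ½ * p ≡ p
  ½*p+½*p≡p p = trans (sym (*-distribʳ-+ p ½ ½)) (*-identityˡ p)

  /-≤ : ∀ a b c d .{{_ : ℕ.NonZero b}} .{{_ : ℕ.NonZero d}} →
        a ℕ.* d ℕ.≤ c ℕ.* b → (+ a) / b ≤ (+ c) / d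
  /-≤ a b@(suc _) c d@(suc _) ad≤cb = toℚᵘ-cancel-≤
    (ℚᵘ.≤-respˡ-≃ (ℚᵘ.≃-sym (toℚᵘ-fromℚᵘ (ℚᵘ.mkℚᵘ (+ a) _)))
    (ℚᵘ.≤-respʳ-≃ (ℚᵘ.≃-sym (toℚᵘ-fromℚᵘ (ℚᵘ.mkℚᵘ (+ c) _)))
    (ℚᵘ.*≤* (subst₂ ℤ._≤_ (ℤ.pos-* a d) (ℤ.pos-* c b) (ℤ.+≤+ ad≤cb)))))

  /-≡ : ∀ a b c d .{{_ : ℕ.NonZero b}} .{{_ : ℕ.NonZero d}} →
        a ℕ.* d ≡ c ℕ.* b → (+ a) / b ≡ (+ c) / d
  /-≡ a b c d eq = ≤-antisym (/-≤ a b c d (ℕ.≤-reflexive eq))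
                             (/-≤ c d a b (ℕ.≤-reflexive (sym eq)))

  /-* : ∀ a b c d → ((+ a) / suc b) * ((+ c) / suc d) ≡ (+ (a ℕ.* c)) / (suc b ℕ.* suc d)
  /-* a b c d = toℚᵘ-injective (ℚᵘ.≃-trans (toℚᵘ-homo-* ((+ a) / suc b) ((+ c) / suc d))
    (ℚᵘ.≃-trans (ℚᵘ.*-cong (toℚᵘ-fromℚᵘ (ℚᵘ.mkℚᵘ (+ a) b)) (toℚᵘ-fromℚᵘ (ℚᵘ.mkℚᵘ (+ c) d)))
    (ℚᵘ.≃-trans (ℚᵘ.≃-reflexive (cong (λ z → ℚᵘ.mkℚᵘ z (d ℕ.+ b ℕ.* suc d)) (sym (ℤ.pos-* a c))))
    (ℚᵘ.≃-sym (toℚᵘ-fromℚᵘ (ℚᵘ.mkℚᵘ (+ (a ℕ.* c)) (d ℕ.+ b ℕ.* suc d)))))))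

  /-+ : ∀ a b c d → ((+ a) / suc b) + ((+ c) / suc d) ≡
                    (+ (a ℕ.* suc d ℕ.+ c ℕ.* suc b)) / (suc b ℕ.* suc d)
  /-+ a b c d = toℚᵘ-injective (ℚᵘ.≃-trans (toℚᵘ-homo-+ ((+ a) / suc b) ((+ c) / suc d))
    (ℚᵘ.≃-trans (ℚᵘ.+-cong (toℚᵘ-fromℚᵘ (ℚᵘ.mkℚᵘ (+ a) b)) (toℚᵘ-fromℚᵘ (ℚᵘ.mkℚᵘ (+ c) d)))
    (ℚᵘ.≃-trans (ℚᵘ.≃-reflexive (cong (λ z → ℚᵘ.mkℚᵘ z (d ℕ.+ b ℕ.* suc d))
      (sym (trans (ℤ.pos-+ (a ℕ.* suc d) (c ℕ.* suc b))
                  (cong₂ ℤ._+_ (ℤ.pos-* a (suc d)) (ℤ.pos-* c (suc b)))))))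
    (ℚᵘ.≃-sym (toℚᵘ-fromℚᵘ (ℚᵘ.mkℚᵘ (+ (a ℕ.* suc d ℕ.+ c ℕ.* suc b)) (d ℕ.+ b ℕ.* suc d)))))))

  0≤+/ : ∀ a b .{{_ : ℕ.NonZero b}} → 0ℚ ≤ (+ a) / b
  0≤+/ a b = nonNegative⁻¹ ((+ a) / b) {{normalize-nonNeg a b}}

  ∣/∣ : ∀ z d .{{_ : ℕ.NonZero d}} → ∣ z / d ∣ ≡ (+ ℤ.∣ z ∣) / d
  ∣/∣ (+ n) d = 0≤p⇒∣p∣≡p (0≤+/ n d)
  ∣/∣ -[1+ n ] d = trans (∣-p∣≡∣p∣ ((+ suc n) / d)) (0≤p⇒∣p∣≡p (0≤+/ (suc n) d))

  archimedean : ∀ ε → 0ℚ < ε → Σ ℕ λ q → (+ 1) / suc q ≤ ε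
  archimedean ε@(mkℚ (+ zero) d c) (*<* 0<ε) = contradiction 0<ε (ℤ.<-irrefl refl)
  archimedean ε@(mkℚ -[1+ n ] d c) (*<* ())
  archimedean ε@(mkℚ (+ suc n) d c) 0<ε = d , subst ((+ 1) / suc d ≤_) (fromℚᵘ-toℚᵘ ε)
    (/-≤ 1 (suc d) (suc n) (suc d) (ℕ.*-monoˡ-≤ (suc d) (s≤s (z≤n {n}))))

open RationalLemmas

IsCauchy : (ℕ → ℚ) → Set
IsCauchy x = ∀ ε → 0ℚ < ε → Σ ℕ λ N → ∀ m n → N ℕ.≤ m → N ℕ.≤ n → ∣ x m - x n ∣ ≤ ε

-- A real is a Cauchy sequence of rationals; equality of reals is _≃ᴿ_.
record ℝ : Set where
  constructor mkℝ
  field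
    seq    : ℕ → ℚ
    cauchy : IsCauchy seq

open ℝ public

infix 4 _≃ᴿ_

_≃ᴿ_ : ℝ → ℝ → Set
x ≃ᴿ y = ∀ ε → 0ℚ < ε → Σ ℕ λ N → ∀ n → N ℕ.≤ n → ∣ seq x n - seq y n ∣ ≤ ε

module CauchyLemmas where

  Null : (ℕ → ℚ) → Set
  Null x = ∀ ε → 0ℚ < ε → Σ ℕ λ N → ∀ n → N ℕ.≤ n → x n ≤ ε

  scale : ∀ {C} → 0ℚ < C → ∀ ε → 0ℚ < ε →
          Σ ℚ λ η → 0ℚ < η × C * η ≡ ε
  scale {C} 0<C ε 0<ε = 1/C * ε , *-pos 0<1/C 0<ε , eq
    where
    instance
      C≢0 : NonZero C
      C≢0 = >-nonZero 0<C
      C-pos : Positive C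
      C-pos = positive 0<C
    1/C : ℚ
    1/C = 1/ C
    0<1/C : 0ℚ < 1/C
    0<1/C = positive⁻¹ 1/C {{1/pos⇒pos C}}
    eq : C * (1/C * ε) ≡ ε
    eq = trans (sym (*-assoc C 1/C ε)) (trans (cong (_* ε) (*-inverseʳ C)) (*-identityˡ ε))

  Null-scale : ∀ {C : ℚ} {x : ℕ → ℚ} → 0ℚ < C → Null x → Null (λ n → C * x n)
  Null-scale {C} {x} 0<C x→0 ε 0<ε with scale 0<C ε 0<ε
  ... | η , 0<η , Cη≡ε with x→0 η 0<η
  ... | N , x≤η = N , λ n N≤n → subst (C * x n ≤_) Cη≡ε
    (*-monoˡ-≤-nonNeg C {{nonNegative (<⇒≤ 0<C)}} (x≤η n N≤n))

  ∣x∣≤tail⇒cauchy : ∀ {x r : ℕ → ℚ} → Null r → (∀ m k → ∣ x (k ℕ.+ m) - x m ∣ ≤ r m) → IsCauchy x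
  ∣x∣≤tail⇒cauchy {x} {r} r→0 tail ε 0<ε with r→0 ε 0<ε
  ... | N , r≤ε = N , both
    where
    ordered : ∀ m n → N ℕ.≤ m → m ℕ.≤ n → ∣ x n - x m ∣ ≤ ε
    ordered m n N≤m m≤n = ≤-trans
      (subst (λ k → ∣ x k - x m ∣ ≤ r m) (ℕ.m∸n+n≡m m≤n) (tail m (n ℕ.∸ m))) (r≤ε m N≤m)
    both : ∀ m n → N ℕ.≤ m → N ℕ.≤ n → ∣ x m - x n ∣ ≤ ε
    both m n N≤m N≤n with ℕ.≤-total m n
    ... | inj₁ m≤n = subst (_≤ ε) (∣p-q∣≡∣q-p∣ (x n) (x m)) (ordered m n N≤m m≤n)
    ... | inj₂ n≤m = ordered n m N≤n n≤m

open CauchyLemmas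

fromℚ : ℚ → ℝ
fromℚ q = mkℝ (λ _ → q) λ ε 0<ε → 0 , λ _ _ _ _ →
  subst (_≤ ε) (sym (cong ∣_∣ (+-inverseʳ q))) (<⇒≤ 0<ε)

infix  8 -ᴿ_
infixl 7 _*ᴿ_
infixl 6 _+ᴿ_ _-ᴿ_

_+ᴿ_ : ℝ → ℝ → ℝ
mkℝ x cx +ᴿ mkℝ y cy = mkℝ (λ n → x n + y n) proof
  where
  open +-*-Solver
  proof : IsCauchy (λ n → x n + y n)
  proof ε 0<ε with cx (½ * ε) (0<½* 0<ε) | cy (½ * ε) (0<½* 0<ε)
  ... | M , hx | N , hy = M ℕ.⊔ N , λ m n m≥ n≥ → subst₂ _≤_
    (cong ∣_∣ (solve 4 (λ a b c d → (a :- b) :+ (c :- d) := (a :+ c) :- (b :+ d)) refl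
      (x m) (x n) (y m) (y n)))
    (½*p+½*p≡p ε)
    (≤-trans (∣p+q∣≤∣p∣+∣q∣ (x m - x n) (y m - y n)) (+-mono-≤
      (hx m n (ℕ.≤-trans (ℕ.m≤m⊔n M N) m≥) (ℕ.≤-trans (ℕ.m≤m⊔n M N) n≥))
      (hy m n (ℕ.≤-trans (ℕ.m≤n⊔m M N) m≥) (ℕ.≤-trans (ℕ.m≤n⊔m M N) n≥))))

-ᴿ_ : ℝ → ℝ
-ᴿ mkℝ x cx = mkℝ (λ n → - x n) proof
  where
  open +-*-Solver
  proof : IsCauchy (λ n → - x n)
  proof ε 0<ε with cx ε 0<ε
  ... | N , h = N , λ m n m≥ n≥ → subst (_≤ ε)
    (trans (∣p-q∣≡∣q-p∣ (x m) (x n))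
      (cong ∣_∣ (solve 2 (λ a b → b :- a := (:- a) :- (:- b)) refl (x m) (x n))))
    (h m n m≥ n≥)

_-ᴿ_ : ℝ → ℝ → ℝ
x -ᴿ y = x +ᴿ -ᴿ y

module ProductLemmas where

  bounded : ∀ {x : ℕ → ℚ} → IsCauchy x → Σ ℚ λ B → 0ℚ < B × Σ ℕ λ N → ∀ n → N ℕ.≤ n → ∣ x n ∣ ≤ B
  bounded {x} cx with cx 1ℚ (positive⁻¹ 1ℚ)
  ... | N , h = 1ℚ + ∣ x N ∣
    , +-mono-<-≤ (positive⁻¹ 1ℚ) (0≤∣p∣ (x N))
    , N
    , λ n n≥ → ≤-trans
        (subst (λ z → ∣ z ∣ ≤ ∣ x n - x N ∣ + ∣ x N ∣)
          (solve 2 (λ a b → (a :- b) :+ b := a) refl (x n) (x N))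
          (∣p+q∣≤∣p∣+∣q∣ (x n - x N) (x N)))
        (+-monoˡ-≤ ∣ x N ∣ (h n N n≥ ℕ.≤-refl))
    where open +-*-Solver

  *-difference : ∀ a b c d → a * (c - d) + d * (a - b) ≡ a * c - b * d
  *-difference = solve 4
    (λ a b c d → a :* (c :- d) :+ d :* (a :- b) := a :* c :- b :* d) refl
    where open +-*-Solver

  ∣*∣-difference : ∀ a b c d A B α β → 0ℚ < A → 0ℚ < B →
    ∣ a ∣ ≤ A → ∣ d ∣ ≤ B → ∣ c - d ∣ ≤ α → ∣ a - b ∣ ≤ β →
    ∣ a * c - b * d ∣ ≤ A * α + B * β
  ∣*∣-difference a b c d A B α β 0<A 0<B a≤A d≤B cd≤α ab≤β = begin
    ∣ a * c - b * d ∣                     ≡⟨ cong ∣_∣ (*-difference a b c d) ⟨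
    ∣ a * (c - d) + d * (a - b) ∣         ≤⟨ ∣p+q∣≤∣p∣+∣q∣ (a * (c - d)) (d * (a - b)) ⟩
    ∣ a * (c - d) ∣ + ∣ d * (a - b) ∣     ≡⟨ cong₂ _+_ (∣p*q∣≡∣p∣*∣q∣ a (c - d)) (∣p*q∣≡∣p∣*∣q∣ d (a - b)) ⟩
    ∣ a ∣ * ∣ c - d ∣ + ∣ d ∣ * ∣ a - b ∣ ≤⟨ +-mono-≤
      (*-mono-nonNeg {∣ a ∣} {A} {∣ c - d ∣} {α} (0≤∣p∣ (c - d)) (<⇒≤ 0<A) a≤A cd≤α)
      (*-mono-nonNeg {∣ d ∣} {B} {∣ a - b ∣} {β} (0≤∣p∣ (a - b)) (<⇒≤ 0<B) d≤B ab≤β) ⟩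
    A * α + B * β ∎
    where open ≤-Reasoning

  *-cauchy : ∀ {x y : ℕ → ℚ} → IsCauchy x → IsCauchy y → IsCauchy (λ n → x n * y n)
  *-cauchy {x} {y} cx cy ε 0<ε = step₁ (bounded {x} cx) (bounded {y} cy)
    where
    Goal : Set
    Goal = Σ ℕ λ N → ∀ m n → N ℕ.≤ m → N ℕ.≤ n → ∣ x m * y m - x n * y n ∣ ≤ ε
    Bound : (ℕ → ℚ) → Set
    Bound x = Σ ℚ λ B → 0ℚ < B × Σ ℕ λ N → ∀ n → N ℕ.≤ n → ∣ x n ∣ ≤ B
    Close : (ℕ → ℚ) → ℚ → Set
    Close x η = Σ ℕ λ N → ∀ m n → N ℕ.≤ m → N ℕ.≤ n → ∣ x m - x n ∣ ≤ η
    Scale : ℚ → Set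
    Scale C = Σ ℚ λ η → 0ℚ < η × C * η ≡ ½ * ε
    step₃ : ((A , _) : Bound x) ((B , _) : Bound y) ((α , _) : Scale A) ((β , _) : Scale B) →
            Close y α → Close x β → Goal
    step₃ (A , 0<A , M₁ , x≤A) (B , 0<B , N₁ , y≤B) (α , 0<α , Aα≡) (β , 0<β , Bβ≡)
          (N₂ , hy) (M₂ , hx) = K , λ m n m≥ n≥ →
      subst (∣ x m * y m - x n * y n ∣ ≤_) (trans (cong₂ _+_ Aα≡ Bβ≡) (½*p+½*p≡p ε))
        (∣*∣-difference (x m) (x n) (y m) (y n) A B α β 0<A 0<B
          (x≤A m (ℕ.≤-trans M₁≤K m≥))
          (y≤B n (ℕ.≤-trans N₁≤K n≥))
          (hy m n (ℕ.≤-trans N₂≤K m≥) (ℕ.≤-trans N₂≤K n≥))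
          (hx m n (ℕ.≤-trans M₂≤K m≥) (ℕ.≤-trans M₂≤K n≥)))
      where
      K : ℕ
      K = (M₁ ℕ.⊔ N₁) ℕ.⊔ (M₂ ℕ.⊔ N₂)
      M₁≤K : M₁ ℕ.≤ K
      M₁≤K = ℕ.≤-trans (ℕ.m≤m⊔n M₁ N₁) (ℕ.m≤m⊔n (M₁ ℕ.⊔ N₁) (M₂ ℕ.⊔ N₂))
      N₁≤K : N₁ ℕ.≤ K
      N₁≤K = ℕ.≤-trans (ℕ.m≤n⊔m M₁ N₁) (ℕ.m≤m⊔n (M₁ ℕ.⊔ N₁) (M₂ ℕ.⊔ N₂))
      M₂≤K : M₂ ℕ.≤ K
      M₂≤K = ℕ.≤-trans (ℕ.m≤m⊔n M₂ N₂) (ℕ.m≤n⊔m (M₁ ℕ.⊔ N₁) (M₂ ℕ.⊔ N₂))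
      N₂≤K : N₂ ℕ.≤ K
      N₂≤K = ℕ.≤-trans (ℕ.m≤n⊔m M₂ N₂) (ℕ.m≤n⊔m (M₁ ℕ.⊔ N₁) (M₂ ℕ.⊔ N₂))
    step₂ : ((A , _) : Bound x) ((B , _) : Bound y) → Scale A → Scale B → Goal
    step₂ bx by sα@(α , 0<α , _) sβ@(β , 0<β , _) = step₃ bx by sα sβ (cy α 0<α) (cx β 0<β)
    step₁ : Bound x → Bound y → Goal
    step₁ bx@(A , 0<A , _) by@(B , 0<B , _) =
      step₂ bx by (scale {A} 0<A (½ * ε) (0<½* 0<ε)) (scale {B} 0<B (½ * ε) (0<½* 0<ε))

open ProductLemmas

_*ᴿ_ : ℝ → ℝ → ℝ
mkℝ x cx *ᴿ mkℝ y cy = mkℝ (λ n → x n * y n) (*-cauchy {x} {y} cx cy)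

-- Positivity is witnessed by a rational lower bound valid from index `from`
-- on; the reciprocal inverts the terms from there.
record Positiveᴿ (x : ℝ) : Set where
  field
    δ     : ℚ
    0<δ   : 0ℚ < δ
    from  : ℕ
    δ≤seq : ∀ n → δ ≤ seq x (n ℕ.+ from)

  seq≢0 : ∀ n → NonZero (seq x (n ℕ.+ from))
  seq≢0 n = >-nonZero (<-≤-trans 0<δ (δ≤seq n))

reciprocal : (x : ℝ) → Positiveᴿ x → ℝ
reciprocal x x>0 = mkℝ inv proof
  where
  open Positiveᴿ x>0
  open +-*-Solver
  y : ℕ → ℚ
  y n = seq x (n ℕ.+ from)
  inv : ℕ → ℚ
  inv n = (1/ y n) {{seq≢0 n}}
  y*inv : ∀ n → y n * inv n ≡ 1ℚ
  y*inv n = *-inverseʳ (y n) {{seq≢0 n}}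
  0<y : ∀ n → 0ℚ < y n
  0<y n = <-≤-trans 0<δ (δ≤seq n)
  0≤inv : ∀ n → 0ℚ ≤ inv n
  0≤inv n = <⇒≤ (positive⁻¹ (inv n) {{1/pos⇒pos (y n) {{positive (0<y n)}}}})
  δ*inv≤1 : ∀ n → δ * inv n ≤ 1ℚ
  δ*inv≤1 n = subst (δ * inv n ≤_) (y*inv n)
    (*-monoʳ-≤-nonNeg (inv n) {{nonNegative (0≤inv n)}} (δ≤seq n))
  difference : ∀ m n → (y n - y m) * (inv m * inv n) ≡ inv m - inv n
  difference m n = trans
    (solve 4 (λ a b c d → (b :- a) :* (c :* d) := (b :* d) :* c :- (a :* c) :* d) refl
      (y m) (y n) (inv m) (inv n))
    (cong₂ _-_
      (trans (cong (_* inv m) (y*inv n)) (*-identityˡ (inv m)))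
      (trans (cong (_* inv n) (y*inv m)) (*-identityˡ (inv n))))
  proof : IsCauchy inv
  proof ε 0<ε with cauchy x ((δ * δ) * ε) (*-pos (*-pos 0<δ 0<δ) 0<ε)
  ... | N , h = N , λ m n m≥ n≥ → subst (_≤ ε)
    (trans (sym (trans (∣p*q∣≡∣p∣*∣q∣ (y n - y m) (inv m * inv n))
             (cong (∣ y n - y m ∣ *_) (0≤p⇒∣p∣≡p (*-nonNeg (0≤inv m) (0≤inv n))))))
           (cong ∣_∣ (difference m n)))
    (≤-trans
      (*-monoʳ-≤-nonNeg (inv m * inv n) {{nonNegative (*-nonNeg (0≤inv m) (0≤inv n))}}
        (h (n ℕ.+ from) (m ℕ.+ from) (ℕ.m≤n⇒m≤n+o from n≥) (ℕ.m≤n⇒m≤n+o from m≥)))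
      (subst₂ _≤_
        (solve 4 (λ d e a b → ((d :* a) :* (d :* b)) :* e := ((d :* d) :* e) :* (a :* b)) refl
          δ ε (inv m) (inv n))
        (*-identityˡ ε)
        (*-monoʳ-≤-nonNeg ε {{nonNegative (<⇒≤ 0<ε)}}
          (*-mono-nonNeg {δ * inv m} {1ℚ} {δ * inv n} {1ℚ} (*-nonNeg (<⇒≤ 0<δ) (0≤inv n))
            (<⇒≤ (positive⁻¹ 1ℚ)) (δ*inv≤1 m) (δ*inv≤1 n)))))

-- The upper limit is exclusive: the sum of f i over i < n.
∑ : ℕ → (ℕ → ℚ) → ℚ
∑ zero    f = 0ℚ
∑ (suc n) f = ∑ n f + f n

module Comparison where

  ∑-tail : ∀ {f : ℕ → ℚ} (G : ℕ → ℚ) → (∀ i → ∣ f i ∣ ≤ G (suc i) - G i) →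
           ∀ m k → ∣ ∑ (k ℕ.+ m) f - ∑ m f ∣ ≤ G (k ℕ.+ m) - G m
  ∑-tail {f} G f≤ m zero = ≤-reflexive
    (trans (cong ∣_∣ (+-inverseʳ (∑ m f))) (sym (+-inverseʳ (G m))))
  ∑-tail {f} G f≤ m (suc k) = subst₂ _≤_
    (cong ∣_∣ (solve 3 (λ s x s₀ → (s :- s₀) :+ x := (s :+ x) :- s₀) refl
      (∑ (k ℕ.+ m) f) (f (k ℕ.+ m)) (∑ m f)))
    (solve 3 (λ a b c → (a :- b) :+ (c :- a) := c :- b) refl
      (G (k ℕ.+ m)) (G m) (G (suc k ℕ.+ m)))
    (≤-trans (∣p+q∣≤∣p∣+∣q∣ (∑ (k ℕ.+ m) f - ∑ m f) (f (k ℕ.+ m)))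
      (+-mono-≤ (∑-tail {f} G f≤ m k) (f≤ (k ℕ.+ m))))
    where open +-*-Solver

  ∑-bound : ∀ {f : ℕ → ℚ} (G : ℕ → ℚ) → (∀ i → ∣ f i ∣ ≤ G (suc i) - G i) → ∀ n → ∣ ∑ n f ∣ ≤ G n - G 0
  ∑-bound {f} G f≤ n = subst₂ (λ s k → ∣ s ∣ ≤ G k - G 0)
    (trans (+-identityʳ (∑ (n ℕ.+ 0) f)) (cong (λ k → ∑ k f) (ℕ.+-identityʳ n)))
    (ℕ.+-identityʳ n) (∑-tail {f} G f≤ 0 n)

  u : ℕ → ℚ
  u i = (+ 1) / suc (2 ℕ.* i)

  0≤u : ∀ i → 0ℚ ≤ u i
  0≤u i = 0≤+/ 1 (suc (2 ℕ.* i))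

  u≤1 : ∀ i → u i ≤ 1ℚ
  u≤1 i = /-≤ 1 (suc (2 ℕ.* i)) 1 1 (s≤s z≤n)

  u-step : ∀ i → u i ≡ u (suc i) + (u i * u (suc i) + u i * u (suc i))
  u-step i = sym (trans
    (cong (λ z → u (suc i) + (z + z)) (/-* 1 (2 ℕ.* i) 1 (2 ℕ.* suc i)))
    (trans (cong (λ z → u (suc i) + z) (/-+ 1 D 1 D))
    (trans (/-+ 1 (2 ℕ.* suc i) (1 ℕ.* suc D ℕ.+ 1 ℕ.* suc D) (D ℕ.+ D ℕ.* suc D))
    (/-≡ (1 ℕ.* suc (D ℕ.+ D ℕ.* suc D) ℕ.+ (1 ℕ.* suc D ℕ.+ 1 ℕ.* suc D) ℕ.* suc (2 ℕ.* suc i))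
         (suc (2 ℕ.* suc i) ℕ.* suc (D ℕ.+ D ℕ.* suc D)) 1 (suc (2 ℕ.* i)) (arith i)))))
    where
    D : ℕ
    D = 2 ℕ.* suc i ℕ.+ (2 ℕ.* i) ℕ.* suc (2 ℕ.* suc i)
    arith : ∀ i → let D = 2 ℕ.* suc i ℕ.+ (2 ℕ.* i) ℕ.* suc (2 ℕ.* suc i) in
      (1 ℕ.* suc (D ℕ.+ D ℕ.* suc D) ℕ.+ (1 ℕ.* suc D ℕ.+ 1 ℕ.* suc D) ℕ.* suc (2 ℕ.* suc i))
        ℕ.* suc (2 ℕ.* i)
      ≡ 1 ℕ.* (suc (2 ℕ.* suc i) ℕ.* suc (D ℕ.+ D ℕ.* suc D))
    arith = solve-∀

  3ℚ : ℚ
  3ℚ = (+ 3) / 1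

  u≤3u : ∀ i → u i ≤ 3ℚ * u (suc i)
  u≤3u i = subst (u i ≤_) (sym (/-* 3 0 1 (2 ℕ.* suc i)))
    (/-≤ 1 (suc (2 ℕ.* i)) 3 (1 ℕ.* suc (2 ℕ.* suc i))
      (subst (1 ℕ.* (1 ℕ.* suc (2 ℕ.* suc i)) ℕ.≤_) (arith i)
        (ℕ.m≤m+n (1 ℕ.* (1 ℕ.* suc (2 ℕ.* suc i))) (4 ℕ.* i))))
    where
    arith : ∀ i → 1 ℕ.* (1 ℕ.* suc (2 ℕ.* suc i)) ℕ.+ 4 ℕ.* i ≡ 3 ℕ.* suc (2 ℕ.* i)
    arith = solve-∀

  -- g n = ∏_{i<n} (1 + 1/(2i+1)) has the growth of √n.
  g : ℕ → ℚ
  g zero    = 1ℚ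
  g (suc i) = g i + u i * g i

  1≤g : ∀ i → 1ℚ ≤ g i
  0≤g : ∀ i → 0ℚ ≤ g i
  0≤g i = ≤-trans (<⇒≤ (positive⁻¹ 1ℚ)) (1≤g i)
  1≤g zero    = ≤-refl
  1≤g (suc i) = ≤-trans (1≤g i) (subst (_≤ g (suc i)) (+-identityʳ (g i))
    (+-monoʳ-≤ (g i) (*-nonNeg (0≤u i) (0≤g i))))

  g-suc≤2g : ∀ i → g (suc i) ≤ g i + g i
  g-suc≤2g i = +-monoʳ-≤ (g i) (subst (u i * g i ≤_) (*-identityˡ (g i))
    (*-monoʳ-≤-nonNeg (g i) {{nonNegative (0≤g i)}} (u≤1 i)))

  h : ℕ → ℚ
  h i = u i * g i

  0≤h : ∀ i → 0ℚ ≤ h i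
  0≤h i = *-nonNeg (0≤u i) (0≤g i)

  h-step : ∀ i → h i - h (suc i) ≡ u i * u (suc i) * g i
  h-step i = trans
    (cong (λ z → z * g i - h (suc i)) (u-step i))
    (solve 3 (λ a b c → (b :+ (a :* b :+ a :* b)) :* c :- b :* (c :+ a :* c) := a :* b :* c) refl
      (u i) (u (suc i)) (g i))
    where open +-*-Solver

  ρ : ℕ → ℚ
  ρ i = (+ (2 ℕ.* suc i)) / suc (2 ℕ.* suc i)

  1-u≡ρ : ∀ i → ρ i + u (suc i) ≡ 1ℚ
  1-u≡ρ i = trans (/-+ (2 ℕ.* suc i) (2 ℕ.* suc i) 1 (2 ℕ.* suc i))
    (/-≡ ((2 ℕ.* suc i) ℕ.* suc (2 ℕ.* suc i) ℕ.+ 1 ℕ.* suc (2 ℕ.* suc i))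
         (suc (2 ℕ.* suc i) ℕ.* suc (2 ℕ.* suc i)) 1 1 (arith i))
    where
    arith : ∀ i → ((2 ℕ.* suc i) ℕ.* suc (2 ℕ.* suc i) ℕ.+ 1 ℕ.* suc (2 ℕ.* suc i)) ℕ.* 1
                  ≡ 1 ℕ.* (suc (2 ℕ.* suc i) ℕ.* suc (2 ℕ.* suc i))
    arith = solve-∀

  h-suc : ∀ i → h (suc i) ≡ ρ i * h i
  h-suc i = trans
    (solve 2 (λ a b → b := a :- (a :- b)) refl (h i) (h (suc i)))
    (trans (cong (λ z → h i - z) (h-step i))
    (trans (cong (_- u i * u (suc i) * g i)
             (trans (sym (*-identityˡ (h i))) (cong (_* h i) (sym (1-u≡ρ i)))))
    (solve 4 (λ r v w x → (r :+ w) :* (v :* x) :- v :* w :* x := r :* (v :* x)) refl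
      (ρ i) (u i) (u (suc i)) (g i))))
    where open +-*-Solver

  h²≤ : ∀ i → h i * h i ≤ (+ 1) / suc i
  h²≤ zero    = ≤-refl
  h²≤ (suc i) = subst (_≤ (+ 1) / suc (suc i))
    (trans (solve 2 (λ a b → (a :* a) :* (b :* b) := (a :* b) :* (a :* b)) refl (ρ i) (h i))
           (cong (λ z → z * z) (sym (h-suc i))))
    (≤-trans
      (*-monoˡ-≤-nonNeg (ρ i * ρ i) {{nonNegative (*-nonNeg 0≤ρ 0≤ρ)}} (h²≤ i))
      (subst (_≤ (+ 1) / suc (suc i))
        (sym (trans (cong (_* ((+ 1) / suc i)) (/-* d d d d)) (/-* (d ℕ.* d) (d ℕ.+ d ℕ.* suc d) 1 i)))
        (/-≤ (d ℕ.* d ℕ.* 1) (suc d ℕ.* suc d ℕ.* suc i) 1 (suc (suc i))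
          (subst (d ℕ.* d ℕ.* 1 ℕ.* suc (suc i) ℕ.≤_) (arith i)
            (ℕ.m≤m+n (d ℕ.* d ℕ.* 1 ℕ.* suc (suc i)) (suc i))))))
    where
    open +-*-Solver
    d : ℕ
    d = 2 ℕ.* suc i
    0≤ρ : 0ℚ ≤ ρ i
    0≤ρ = 0≤+/ d (suc d)
    arith : ∀ i → let d = 2 ℕ.* suc i in
      d ℕ.* d ℕ.* 1 ℕ.* suc (suc i) ℕ.+ suc i ≡ 1 ℕ.* (suc d ℕ.* suc d ℕ.* suc i)
    arith = solve-∀

  h→0 : Null h
  h→0 ε 0<ε with archimedean ε 0<ε
  ... | q , 1/q≤ε = suc q ℕ.* suc q , λ n n≥ → ≤-trans (small n n≥) 1/q≤ε
    where
    r : ℚ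
    r = (+ 1) / suc q
    small : ∀ n → suc q ℕ.* suc q ℕ.≤ n → h n ≤ r
    small n n≥ with h n ≤? r
    ... | yes h≤r = h≤r
    ... | no  h≰r = contradiction (<-≤-trans r²<h² h²≤r²) (<-irrefl refl)
      where
      r<h : r < h n
      r<h = ≰⇒> h≰r
      0<r : 0ℚ < r
      0<r = positive⁻¹ r {{normalize-pos 1 (suc q)}}
      r²<h² : r * r < h n * h n
      r²<h² = <-trans (*-monoˡ-<-pos r {{positive 0<r}} r<h)
                      (*-monoʳ-<-pos (h n) {{positive (<-trans 0<r r<h)}} r<h)
      h²≤r² : h n * h n ≤ r * r
      h²≤r² = ≤-trans (h²≤ n) (subst ((+ 1) / suc n ≤_) (sym (/-* 1 q 1 q))
        (/-≤ 1 (suc n) 1 (suc q ℕ.* suc q)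
          (ℕ.*-monoʳ-≤ 1 (ℕ.≤-trans n≥ (ℕ.n≤1+n n)))))

  Moderate : (ℕ → ℚ) → Set
  Moderate x = Σ ℚ λ C → 0ℚ < C × (∀ n → ∣ x n ∣ ≤ C * g n)

  moderate-1 : Moderate (λ _ → 1ℚ)
  moderate-1 = 1ℚ , positive⁻¹ 1ℚ , λ n → subst (1ℚ ≤_) (sym (*-identityˡ (g n))) (1≤g n)

  moderate-suc : ∀ {x : ℕ → ℚ} → Moderate x → Moderate (λ n → x (suc n))
  moderate-suc {x} (C , 0<C , x≤) = C + C , +-mono-< 0<C 0<C , λ n → ≤-trans (x≤ (suc n))
    (subst (C * g (suc n) ≤_)
      (solve 2 (λ c y → c :* (y :+ y) := (c :+ c) :* y) refl C (g n))
      (*-monoˡ-≤-nonNeg C {{nonNegative (<⇒≤ 0<C)}} (g-suc≤2g n)))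
    where open +-*-Solver

  moderate-∑ : ∀ {x f : ℕ → ℚ} → Moderate x → (∀ i → ∣ f i ∣ ≤ u i) → Moderate (λ n → ∑ n (λ i → f i * x i))
  moderate-∑ {x} {f} (C , 0<C , x≤) f≤u = C , 0<C , λ n → ≤-trans
    (∑-bound {λ i → f i * x i} (λ i → C * g i) step n)
    (p-q≤p (C * g n) (*-nonNeg (<⇒≤ 0<C) (0≤g 0)))
    where
    open +-*-Solver
    step : ∀ i → ∣ f i * x i ∣ ≤ C * g (suc i) - C * g i
    step i = subst₂ _≤_
      (sym (∣p*q∣≡∣p∣*∣q∣ (f i) (x i)))
      (solve 3 (λ v c y → v :* (c :* y) := c :* (y :+ v :* y) :- c :* y) refl (u i) C (g i))
      (*-mono-nonNeg {∣ f i ∣} {u i} {∣ x i ∣} {C * g i} (0≤∣p∣ (x i)) (0≤u i) (f≤u i) (x≤ i))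

  cauchy-∑ : ∀ {x f : ℕ → ℚ} → Moderate x → (∀ i → ∣ f i ∣ ≤ u i * u i) →
             IsCauchy (λ n → ∑ n (λ i → f i * x i))
  cauchy-∑ {x} {f} (C , 0<C , x≤) f≤u² = ∣x∣≤tail⇒cauchy
    {λ n → ∑ n (λ i → f i * x i)} {λ m → D * h m} (Null-scale {D} {h} 0<D h→0)
    λ m k → ≤-trans
      (∑-tail {λ i → f i * x i} (λ i → - (D * h i)) step m k)
      (subst (_≤ D * h m)
        (solve 2 (λ a b → a :- b := (:- b) :- (:- a)) refl (D * h m) (D * h (k ℕ.+ m)))
        (p-q≤p (D * h m) (*-nonNeg (<⇒≤ 0<D) (0≤h (k ℕ.+ m)))))
    where
    open +-*-Solver
    D : ℚ
    D = 3ℚ * C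
    0<D : 0ℚ < D
    0<D = *-pos (positive⁻¹ 3ℚ) 0<C
    step : ∀ i → ∣ f i * x i ∣ ≤ - (D * h (suc i)) - (- (D * h i))
    step i = subst₂ _≤_
      (sym (∣p*q∣≡∣p∣*∣q∣ (f i) (x i)))
      (trans
        (solve 5 (λ v w t c y → (v :* (t :* w)) :* (c :* y) := (t :* c) :* (v :* w :* y)) refl
          (u i) (u (suc i)) 3ℚ C (g i))
        (trans (cong (D *_) (sym (h-step i)))
          (solve 3 (λ d a b → d :* (a :- b) := (:- (d :* b)) :- (:- (d :* a))) refl
            D (h i) (h (suc i)))))
      (*-mono-nonNeg {∣ f i ∣} {u i * (3ℚ * u (suc i))} {∣ x i ∣} {C * g i} (0≤∣p∣ (x i)) (*-nonNeg (0≤u i) (≤-trans (0≤u i) (u≤3u i)))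
        (≤-trans (f≤u² i) (*-monoˡ-≤-nonNeg (u i) {{nonNegative (0≤u i)}} (u≤3u i)))
        (x≤ i))

open Comparison

-- bar s stands for s̄, i.e. exponent s with σ = -1.
data Entry : Set where
  plain bar : ℕ → Entry

exponent : Entry → ℕ
exponent (plain s) = s
exponent (bar s)   = s

sign : Entry → ℤ
sign (plain _) = 1ℤ
sign (bar _)   = -1ℤ

-- s₁ > 1, which makes the series absolutely convergent whatever the signs; the
-- only conditionally convergent case, t with first entry bar 1, is left out.
data Admissible : List ℕ → Set where
  admissible : ∀ {s ss} → 1 ℕ.< s → All (1 ℕ.≤_) ss → Admissible (s ∷ ss)

admissible? : ∀ s → Dec (Admissible s)
admissible? []       = no λ ()
admissible? (s ∷ ss) = map′ (λ (p , q) → admissible p q) (λ { (admissible p q) → p , q })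
  ((1 ℕ.<? s) ×-dec all? (1 ℕ.≤?_) ss)

-- Settles admissibility by computation when every entry has the form
-- (literal + n), as in t (bar (2 + 2 * a) ∷ []) admissible!.
admissible! : ∀ {s} {_ : True (admissible? s)} → Admissible s
admissible! {_} {p} = toWitness p

module Twos where

  1≤2s : ∀ a → All (1 ℕ.≤_) (replicate a 2)
  1≤2s zero    = []
  1≤2s (suc a) = s≤s z≤n ∷ 1≤2s a

open Twos

admissible-2-3-2-s-2 : ∀ a b c {s} → 1 ℕ.≤ s →
  Admissible (replicate a 2 ++ 3 ∷ replicate b 2 ++ s ∷ replicate c 2)
admissible-2-3-2-s-2 zero    b c 1≤s =
  admissible (s≤s (s≤s z≤n)) (All.++⁺ (1≤2s b) (1≤s ∷ 1≤2s c))
admissible-2-3-2-s-2 (suc a) b c 1≤s =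
  admissible (s≤s (s≤s z≤n)) (All.++⁺ (1≤2s a) (s≤s z≤n ∷ All.++⁺ (1≤2s b) (1≤s ∷ 1≤2s c)))

-- The summation variables are shifted by one, k = i + 1, so that
-- 2k - 1 = suc (2 * i) and k₂ < k₁ (k₂ ≤ k₁) reads i₂ < i₁ (i₂ < suc i₁).

-- σᵏ / (2k - 1)ˢ
term : Entry → ℕ → ℚ
term e i = _/_ (sign e ℤ.^ suc i) (suc (2 ℕ.* i) ℕ.^ exponent e)
             {{ℕ.m^n≢0 (suc (2 ℕ.* i)) (exponent e)}}

-- Truncations to n ≥ k₁ > ⋯ > k_r ≥ 1, respectively n ≥ k₁ ≥ ⋯ ≥ k_r ≥ 1.
tSum : List Entry → ℕ → ℚ
tSum []       n = 1ℚ
tSum (e ∷ es) n = ∑ n λ i → term e i * tSum es i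

t⋆Sum : List ℕ → ℕ → ℚ
t⋆Sum []       n = 1ℚ
t⋆Sum (s ∷ ss) n = ∑ n λ i → term (plain s) i * t⋆Sum ss (suc i)

module Convergence where

  ∣sign^∣ : ∀ e k → ℤ.∣ sign e ℤ.^ k ∣ ≡ 1
  ∣sign^∣ e zero    = refl
  ∣sign^∣ e (suc k) = trans (ℤ.abs-* (sign e) (sign e ℤ.^ k)) (cong₂ ℕ._*_ (∣sign∣ e) (∣sign^∣ e k))
    where
    ∣sign∣ : ∀ e → ℤ.∣ sign e ∣ ≡ 1
    ∣sign∣ (plain _) = refl
    ∣sign∣ (bar _)   = refl

  term-bound : ∀ e k i → k ℕ.≤ exponent e →
    ∣ term e i ∣ ≤ _/_ (+ 1) (suc (2 ℕ.* i) ℕ.^ k) {{ℕ.m^n≢0 (suc (2 ℕ.* i)) k}}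
  term-bound e k i k≤ = subst (_≤ (+ 1) / (b ℕ.^ k))
    (sym (trans (∣/∣ (sign e ℤ.^ suc i) (b ℕ.^ exponent e))
                (cong (λ z → (+ z) / (b ℕ.^ exponent e)) (∣sign^∣ e (suc i)))))
    (/-≤ 1 (b ℕ.^ exponent e) 1 (b ℕ.^ k) (ℕ.*-monoʳ-≤ 1 (ℕ.^-monoʳ-≤ b k≤)))
    where
    b : ℕ
    b = suc (2 ℕ.* i)
    instance
      bᵏ≢0 : ℕ.NonZero (b ℕ.^ k)
      bᵏ≢0 = ℕ.m^n≢0 b k
      bˢ≢0 : ℕ.NonZero (b ℕ.^ exponent e)
      bˢ≢0 = ℕ.m^n≢0 b (exponent e)

  term≤u : ∀ e → 1 ℕ.≤ exponent e → ∀ i → ∣ term e i ∣ ≤ u i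
  term≤u e 1≤s i = ≤-trans (term-bound e 1 i 1≤s)
    (/-≤ 1 (b ℕ.^ 1) 1 b {{ℕ.m^n≢0 b 1}}
      (ℕ.≤-reflexive (cong (1 ℕ.*_) (sym (ℕ.*-identityʳ b)))))
    where
    b : ℕ
    b = suc (2 ℕ.* i)

  term≤u² : ∀ e → 1 ℕ.< exponent e → ∀ i → ∣ term e i ∣ ≤ u i * u i
  term≤u² e 1<s i = ≤-trans (term-bound e 2 i 1<s)
    (subst (_/_ (+ 1) (b ℕ.^ 2) {{ℕ.m^n≢0 b 2}} ≤_) (sym (/-* 1 (2 ℕ.* i) 1 (2 ℕ.* i)))
      (/-≤ 1 (b ℕ.^ 2) 1 (b ℕ.* b) {{ℕ.m^n≢0 b 2}}
        (ℕ.≤-reflexive (cong (λ z → 1 ℕ.* (b ℕ.* z)) (sym (ℕ.*-identityʳ b))))))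
    where
    b : ℕ
    b = suc (2 ℕ.* i)

  tSum-moderate : ∀ es → All (1 ℕ.≤_) (map exponent es) → Moderate (tSum es)
  tSum-moderate []       []       = moderate-1
  tSum-moderate (e ∷ es) (p ∷ ps) = moderate-∑ {tSum es} {term e} (tSum-moderate es ps) (term≤u e p)

  t⋆Sum-moderate : ∀ ss → All (1 ℕ.≤_) ss → Moderate (t⋆Sum ss)
  t⋆Sum-moderate []       []       = moderate-1
  t⋆Sum-moderate (s ∷ ss) (p ∷ ps) =
    moderate-∑ {λ i → t⋆Sum ss (suc i)} {term (plain s)}
      (moderate-suc {t⋆Sum ss} (t⋆Sum-moderate ss ps)) (term≤u (plain s) p)

  tSum-cauchy : ∀ es → Admissible (map exponent es) → IsCauchy (tSum es)
  tSum-cauchy (e ∷ es) (admissible p ps) = cauchy-∑ {tSum es} {term e} (tSum-moderate es ps) (term≤u² e p)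

  t⋆Sum-cauchy : ∀ ss → Admissible ss → IsCauchy (t⋆Sum ss)
  t⋆Sum-cauchy (s ∷ ss) (admissible p ps) =
    cauchy-∑ {λ i → t⋆Sum ss (suc i)} {term (plain s)}
      (moderate-suc {t⋆Sum ss} (t⋆Sum-moderate ss ps)) (term≤u² (plain s) p)

open Convergence

t : (s : List Entry) → Admissible (map exponent s) → ℝ
t s adm = mkℝ (tSum s) (tSum-cauchy s adm)

t⋆ : (s : List ℕ) → Admissible s → ℝ
t⋆ s adm = mkℝ (t⋆Sum s) (t⋆Sum-cauchy s adm)

-- Leibniz: π = 4 (1 - 1/3 + 1/5 - ⋯)
πSum : ℕ → ℚ
πSum n = ∑ n λ i → ((+ 4) / 1) * ((-1ℤ ℤ.^ i) / suc (2 ℕ.* i))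

module Leibniz where

  alt : ℕ → ℚ
  alt zero    = 1ℚ
  alt (suc m) = - alt m

  alt² : ∀ m → alt m * alt m ≡ 1ℚ
  alt² zero    = refl
  alt² (suc m) = trans
    (solve 1 (λ a → (:- a) :* (:- a) := a :* a) refl (alt m)) (alt² m)
    where open +-*-Solver

  ∣alt∣ : ∀ m → ∣ alt m ∣ ≡ 1ℚ
  ∣alt∣ zero    = refl
  ∣alt∣ (suc m) = trans (∣-p∣≡∣p∣ (alt m)) (∣alt∣ m)

  neg-/ : ∀ z d .{{_ : ℕ.NonZero d}} → (ℤ.- z) / d ≡ - (z / d)
  neg-/ (+ zero)  d = trans (0/n≡0 d) (cong -_ (sym (0/n≡0 d)))
  neg-/ (+ suc n) d = refl
  neg-/ -[1+ n ]  d = solve 1 (λ a → a := :- (:- a)) refl ((+ suc n) / d)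
    where open +-*-Solver

  -1^/ : ∀ k d .{{_ : ℕ.NonZero d}} → (-1ℤ ℤ.^ k) / d ≡ alt k * ((+ 1) / d)
  -1^/ zero    d = sym (*-identityˡ ((+ 1) / d))
  -1^/ (suc k) d = trans (cong (_/ d) (ℤ.-1*i≡-i (-1ℤ ℤ.^ k)))
    (trans (neg-/ (-1ℤ ℤ.^ k) d)
    (trans (cong -_ (-1^/ k d)) (neg-distribˡ-* (alt k) ((+ 1) / d))))

  4ℚ : ℚ
  4ℚ = (+ 4) / 1

  u-anti : ∀ i → u (suc i) ≤ u i
  u-anti i = subst₂ _≤_ (+-identityʳ (u (suc i))) (sym (u-step i))
    (+-monoʳ-≤ (u (suc i)) (+-nonNeg (*-nonNeg (0≤u i) (0≤u (suc i))) (*-nonNeg (0≤u i) (0≤u (suc i)))))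

  0≤4u : ∀ i → 0ℚ ≤ 4ℚ * u i
  0≤4u i = *-nonNeg (<⇒≤ (positive⁻¹ 4ℚ)) (0≤u i)

  leibniz : ∀ k m → (0ℚ ≤ alt m * (πSum (k ℕ.+ m) - πSum m)) ×
                    (alt m * (πSum (k ℕ.+ m) - πSum m) ≤ 4ℚ * u m)
  leibniz zero m =
    let eq = trans (cong (alt m *_) (+-inverseʳ (πSum m))) (*-zeroʳ (alt m))
    in ≤-reflexive (sym eq) , subst (_≤ 4ℚ * u m) (sym eq) (0≤4u m)
  leibniz (suc k) m with leibniz k (suc m)
  ... | 0≤r , r≤ = subst (0ℚ ≤_) eq (p≤q⇒0≤q-p (≤-trans r≤ (*-monoˡ-≤-nonNeg 4ℚ (u-anti m))))
                 , subst (_≤ 4ℚ * u m) eq (p-q≤p (4ℚ * u m) 0≤r)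
    where
    open +-*-Solver
    x = πSum (k ℕ.+ suc m)
    p = πSum m
    v = (-1ℤ ℤ.^ m) / suc (2 ℕ.* m)
    eq : 4ℚ * u m - (- alt m) * (x - (p + 4ℚ * v)) ≡ alt m * (πSum (suc k ℕ.+ m) - p)
    eq = trans (cong (λ z → 4ℚ * u m - (- alt m) * (x - (p + 4ℚ * z))) (-1^/ m (suc (2 ℕ.* m))))
      (trans (solve 5 (λ f w a x p →
          f :* w :- (:- a) :* (x :- (p :+ f :* (a :* w)))
          := (a :* (x :- p) :+ f :* w) :- (a :* a) :* (f :* w)) refl
        4ℚ (u m) (alt m) x p)
      (trans (cong (λ z → (alt m * (x - p) + 4ℚ * u m) - z * (4ℚ * u m)) (alt² m))
      (trans (cong (λ z → (alt m * (x - p) + 4ℚ * u m) - z) (*-identityˡ (4ℚ * u m)))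
      (trans (solve 2 (λ a b → (a :+ b) :- b := a) refl (alt m * (x - p)) (4ℚ * u m))
             (cong (λ j → alt m * (πSum j - p)) (ℕ.+-suc k m))))))

  u→0 : Null u
  u→0 ε 0<ε with archimedean ε 0<ε
  ... | q , 1/q≤ε = q , λ n q≤n → ≤-trans
    (/-≤ 1 (suc (2 ℕ.* n)) 1 (suc q)
      (ℕ.*-monoʳ-≤ 1 (s≤s (ℕ.≤-trans q≤n (ℕ.m≤m+n n (n ℕ.+ 0)))))) 1/q≤ε

  πSum-cauchy : IsCauchy πSum
  πSum-cauchy = ∣x∣≤tail⇒cauchy {πSum} {λ m → 4ℚ * u m} (Null-scale {4ℚ} {u} (positive⁻¹ 4ℚ) u→0)
    λ m k → let d = πSum (k ℕ.+ m) - πSum m in subst (_≤ 4ℚ * u m)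
      (trans (sym (0≤p⇒∣p∣≡p (proj₁ (leibniz k m))))
      (trans (∣p*q∣≡∣p∣*∣q∣ (alt m) d)
      (trans (cong (_* ∣ d ∣) (∣alt∣ m)) (*-identityˡ ∣ d ∣))))
      (proj₂ (leibniz k m))

open Leibniz

π : ℝ
π = mkℝ πSum πSum-cauchy

π>0 : Positiveᴿ π
π>0 = record
  { δ     = πSum 2
  ; 0<δ   = positive⁻¹ (πSum 2)
  ; from  = 2
  ; δ≤seq = λ n → subst₂ _≤_
      (+-identityʳ (πSum 2))
      (trans (cong (λ z → πSum 2 + z) (*-identityˡ (πSum (n ℕ.+ 2) - πSum 2)))
        (solve 2 (λ a b → a :+ (b :- a) := b) refl (πSum 2) (πSum (n ℕ.+ 2))))
      (+-monoʳ-≤ (πSum 2) (proj₁ (leibniz n 2)))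
  }
  where open +-*-Solver

infix 9 _/π

_/π : ℕ → ℝ
n /π = fromℚ ((+ n) / 1) *ᴿ reciprocal π π>0

{-# OPTIONS --safe #-}
module Submission where

-- Write aₖ = 2k+1 (k ≥ 0).  Partial fractions of ∏_{j<n} (1 - x²/aⱼ²)⁻¹ suggest
-- the weights w(n,k) = Cₙ r(n,k) and the functional Φₙ(X) = Σ_{k<n} w(n,k) (-1)ᵏ Xₖ/aₖ.
-- The truncated star sums satisfy t⋆ₙ(s) = Φₙ(Z) exactly, where Z is built from the
-- right end of s, starting from Z = 1: prepending
--   2 replaces Zₖ by Zₖ/aₖ²,
--   3 replaces Zₖ by (Bₖ + Bₖ₊₁)/aₖ, with Bₖ = Σ_{i<k} Zᵢ/aᵢ²,
--   1 replaces Zₖ by (-1)ᵏ(Dₖ + Dₖ₊₁), with Dₖ = Σ_{i<k} (-1)ⁱ Zᵢ/aᵢ;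
-- each case is a summation by parts based on the two-term recurrence of w in k.
-- Since r(n,0) = 1, r(n,k) decreases in k to r(n,n) = 0, and r(n,k) → 1 as n → ∞,
-- Σ_{k<n} r(n,k) zₖ has the same limit as Σ_{k<n} zₖ, even if the latter converges only
-- conditionally.  For Z = 1 this gives Cₙ → 4/π, as Φₙ(1) = 1 and the series is
-- Leibniz's; for the Z of the theorem, expanding B and D gives the four t-values.

open import Defs
open import Data.Nat using (ℕ; _+_; _*_; s≤s; z≤n)
open import Data.List using ([]; _∷_; _++_; replicate)
open import Data.Product using (_×_)
open import Data.Nat as ℕ using (zero; suc; _∸_)
import Data.Nat.Properties as ℕ
open import Data.Nat.Tactic.RingSolver using (solve-∀)
open import Data.Integer as ℤ using (+_; -1ℤ)
import Data.Integer.Properties as ℤ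
open import Data.List using (List)
open import Data.List.Properties using (++-identityʳ)
open import Data.Product using (Σ; _,_; proj₁; proj₂)
open import Data.Sum using (inj₁; inj₂)
open import Data.Rational as ℚ using (ℚ; 0ℚ; 1ℚ; ½; _/_; -_; ∣_∣)
open import Data.Rational.Properties
open import Data.Rational.Solver using (module +-*-Solver)
open import Relation.Binary.PropositionalEquality
open RationalLemmas
open CauchyLemmas
open ProductLemmas
open Comparison
open Leibniz
open +-*-Solver using (solve; con; _:+_; _:*_; _:-_; _:=_) renaming (:-_ to ⊖_)

-- Arithmetic of rationals and of finite sums.

private
  infixl 6 _⊕_ _⊝_
  infixl 7 _⊛_
  _⊕_ _⊝_ _⊛_ : ℚ → ℚ → ℚ
  _⊕_ = ℚ._+_
  _⊝_ = ℚ._-_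
  _⊛_ = ℚ._*_

-- Extends the ring solver to identities that hold modulo relations: `c` is the cofactor with which
-- the relation `p ≡ q` enters, and the last argument is then a pure ring identity.
modulo : ∀ {x y p q : ℚ} c → p ≡ q → x ≡ y ⊕ c ⊛ (p ⊝ q) → x ≡ y
modulo {y = y} {p} c refl eq = trans eq
  (solve 3 (λ y c p → y :+ c :* (p :- p) := y) refl y c p)

modulo₂ : ∀ {x y p q p′ q′ : ℚ} c c′ → p ≡ q → p′ ≡ q′ → x ≡ y ⊕ c ⊛ (p ⊝ q) ⊕ c′ ⊛ (p′ ⊝ q′) → x ≡ y
modulo₂ c c′ eq eq′ h = modulo c eq (modulo c′ eq′ h)

modulo₃ : ∀ {x y p q p′ q′ p″ q″ : ℚ} c c′ c″ → p ≡ q → p′ ≡ q′ → p″ ≡ q″ →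
          x ≡ y ⊕ c ⊛ (p ⊝ q) ⊕ c′ ⊛ (p′ ⊝ q′) ⊕ c″ ⊛ (p″ ⊝ q″) → x ≡ y
modulo₃ c c′ c″ eq eq′ eq″ h = modulo₂ c c′ eq eq′ (modulo c″ eq″ h)

ι : ℕ → ℚ
ι n = (+ n) / 1

ι-+ : ∀ m n → ι (m + n) ≡ ι m ⊕ ι n
ι-+ m n = sym (trans (/-+ m 0 n 0) (/-≡ (m * 1 + n * 1) 1 (m + n) 1 (arith m n)))
  where
  arith : ∀ m n → (m * 1 + n * 1) * 1 ≡ (m + n) * 1
  arith = solve-∀

ι-* : ∀ m n → ι (m * n) ≡ ι m ⊛ ι n
ι-* m n = sym (/-* m 0 n 0)

ι*/ : ∀ c d → ι (suc d) ⊛ ((+ c) / suc d) ≡ ι c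
ι*/ c d = trans (/-* (suc d) 0 c d) (/-≡ (suc d * c) (1 * suc d) c 1 (arith c d))
  where
  arith : ∀ c d → suc d * c * 1 ≡ c * (1 * suc d)
  arith = solve-∀

2ℚ : ℚ
2ℚ = 1ℚ ⊕ 1ℚ

odd : ℕ → ℚ
odd k = ι (suc (2 * k))

odd*u : ∀ k → odd k ⊛ u k ≡ 1ℚ
odd*u k = ι*/ 1 (2 * k)

odd≡ : ∀ k → odd k ≡ 1ℚ ⊕ 2ℚ ⊛ ι k
odd≡ k = trans (ι-+ 1 (2 * k)) (cong (1ℚ ⊕_) (ι-* 2 k))

odd-suc : ∀ k → odd (suc k) ≡ odd k ⊕ 2ℚ
odd-suc k = trans (odd≡ (suc k)) (trans (cong (λ z → 1ℚ ⊕ 2ℚ ⊛ z) (ι-+ 1 k))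
  (trans (solve 1 (λ x → con 1ℚ :+ con 2ℚ :* (con 1ℚ :+ x) := con 1ℚ :+ con 2ℚ :* x :+ con 2ℚ) refl (ι k))
    (cong (_⊕ 2ℚ) (sym (odd≡ k)))))

0<odd : ∀ k → 0ℚ ℚ.< odd k
0<odd k = positive⁻¹ (odd k) {{normalize-pos (suc (2 * k)) 1}}

*-cancelˡ : ∀ c {x y} → 0ℚ ℚ.< c → c ⊛ x ≡ c ⊛ y → x ≡ y
*-cancelˡ c {x} {y} 0<c eq = ≤-antisym
  (*-cancelˡ-≤-pos c {{ℚ.positive 0<c}} (≤-reflexive eq))
  (*-cancelˡ-≤-pos c {{ℚ.positive 0<c}} (≤-reflexive (sym eq)))

∑-cong : ∀ n {f g : ℕ → ℚ} → (∀ i → f i ≡ g i) → ∑ n f ≡ ∑ n g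
∑-cong zero    eq = refl
∑-cong (suc n) eq = cong₂ _⊕_ (∑-cong n eq) (eq n)

∑-+ : ∀ n (f g : ℕ → ℚ) → ∑ n (λ i → f i ⊕ g i) ≡ ∑ n f ⊕ ∑ n g
∑-+ zero    f g = refl
∑-+ (suc n) f g = trans (cong (_⊕ (f n ⊕ g n)) (∑-+ n f g))
  (solve 4 (λ a b c d → (a :+ b) :+ (c :+ d) := (a :+ c) :+ (b :+ d)) refl (∑ n f) (∑ n g) (f n) (g n))

∑-* : ∀ n c (f : ℕ → ℚ) → ∑ n (λ i → c ⊛ f i) ≡ c ⊛ ∑ n f
∑-* zero    c f = sym (*-zeroʳ c)
∑-* (suc n) c f = trans (cong (_⊕ c ⊛ f n) (∑-* n c f)) (sym (*-distribˡ-+ c (∑ n f) (f n)))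

-- The weights and their recurrences.

ratio : ℕ → ℕ → ℚ
ratio n k = (+ (n ∸ suc k)) / suc (n + k)

-- r n k = n!(n-1)! / ((n-1-k)!(n+k)!), which vanishes for k ≥ n > 0.
r : ℕ → ℕ → ℚ
r n zero    = 1ℚ
r n (suc k) = r n k ⊛ ratio n k

r-vanishes : ∀ m k → m ℕ.< k → r (suc m) k ≡ 0ℚ
r-vanishes m (suc k) (s≤s m≤k) = trans (cong (r (suc m) k ⊛_) ratio≡0) (*-zeroʳ (r (suc m) k))
  where
  ratio≡0 : ratio (suc m) k ≡ 0ℚ
  ratio≡0 = trans (cong (λ z → (+ z) / suc (suc m + k)) (ℕ.m≤n⇒m∸n≡0 m≤k)) (0/n≡0 (suc (suc m + k)))

odd-difference : ∀ {m k} → k ℕ.≤ m → odd m ≡ odd k ⊕ 2ℚ ⊛ ι (m ∸ k)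
odd-difference {m} {k} k≤m = begin
  odd m                                ≡⟨ cong odd (ℕ.m+[n∸m]≡n k≤m) ⟨
  odd (k + (m ∸ k))                    ≡⟨ odd≡ (k + (m ∸ k)) ⟩
  1ℚ ⊕ 2ℚ ⊛ ι (k + (m ∸ k))            ≡⟨ cong (λ z → 1ℚ ⊕ 2ℚ ⊛ z) (ι-+ k (m ∸ k)) ⟩
  1ℚ ⊕ 2ℚ ⊛ (ι k ⊕ ι (m ∸ k))          ≡⟨ solve 2 (λ x y → con 1ℚ :+ con 2ℚ :* (x :+ y) := con 1ℚ :+ con 2ℚ :* x :+ con 2ℚ :* y) refl (ι k) (ι (m ∸ k)) ⟩
  1ℚ ⊕ 2ℚ ⊛ ι k ⊕ 2ℚ ⊛ ι (m ∸ k)       ≡⟨ cong (_⊕ 2ℚ ⊛ ι (m ∸ k)) (odd≡ k) ⟨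
  odd k ⊕ 2ℚ ⊛ ι (m ∸ k)               ∎
  where open ≡-Reasoning

odd-sum : ∀ m k → odd m ⊕ odd (suc k) ≡ 2ℚ ⊛ ι (suc (suc m + k))
odd-sum m k = begin
  odd m ⊕ odd (suc k)                            ≡⟨ cong₂ _⊕_ (odd≡ m) (odd-suc k) ⟩
  1ℚ ⊕ 2ℚ ⊛ ι m ⊕ (odd k ⊕ 2ℚ)                   ≡⟨ cong (λ z → 1ℚ ⊕ 2ℚ ⊛ ι m ⊕ (z ⊕ 2ℚ)) (odd≡ k) ⟩
  1ℚ ⊕ 2ℚ ⊛ ι m ⊕ (1ℚ ⊕ 2ℚ ⊛ ι k ⊕ 2ℚ)           ≡⟨ solve 2 (λ x y → con 1ℚ :+ con 2ℚ :* x :+ (con 1ℚ :+ con 2ℚ :* y :+ con 2ℚ) := con 2ℚ :* (con 2ℚ :+ (x :+ y))) refl (ι m) (ι k) ⟩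
  2ℚ ⊛ (2ℚ ⊕ (ι m ⊕ ι k))                        ≡⟨ cong (λ z → 2ℚ ⊛ (2ℚ ⊕ z)) (ι-+ m k) ⟨
  2ℚ ⊛ (2ℚ ⊕ ι (m + k))                          ≡⟨ cong (2ℚ ⊛_) (ι-+ 2 (m + k)) ⟨
  2ℚ ⊛ ι (suc (suc m + k))                       ∎
  where open ≡-Reasoning

-- With n = m + 1, `odd m ⊕ odd (suc k)` is twice the denominator of `ratio n k` and, for k ≤ m,
-- `odd m ⊝ odd k` is twice its numerator.
r-step : ∀ m k → (odd m ⊕ odd (suc k)) ⊛ r (suc m) (suc k) ≡ (odd m ⊝ odd k) ⊛ r (suc m) k
r-step m k with ℕ.≤-<-connex k m
... | inj₁ k≤m = begin
  (odd m ⊕ odd (suc k)) ⊛ (x ⊛ q)  ≡⟨ cong (_⊛ (x ⊛ q)) (odd-sum m k) ⟩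
  2ℚ ⊛ d ⊛ (x ⊛ q)                 ≡⟨ modulo (2ℚ ⊛ x) (ι*/ (m ∸ k) (suc m + k))
    (solve 5 (λ d x q c o → con 2ℚ :* d :* (x :* q) :=
      (o :+ con 2ℚ :* c :- o) :* x :+ con 2ℚ :* x :* (d :* q :- c)) refl d x q (ι (m ∸ k)) (odd k)) ⟩
  (odd k ⊕ 2ℚ ⊛ ι (m ∸ k) ⊝ odd k) ⊛ x ≡⟨ cong (λ z → (z ⊝ odd k) ⊛ x) (odd-difference k≤m) ⟨
  (odd m ⊝ odd k) ⊛ x              ∎
  where
  open ≡-Reasoning
  x = r (suc m) k
  q = ratio (suc m) k
  d = ι (suc (suc m + k))
-- Here the truncated `m ∸ k` no longer matches the negative `odd m ⊝ odd k`, but both values of `r`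
-- are 0.
... | inj₂ m<k = trans
  (trans (cong (λ z → (odd m ⊕ odd (suc k)) ⊛ z) (r-vanishes m (suc k) (ℕ.m<n⇒m<1+n m<k))) (*-zeroʳ (odd m ⊕ odd (suc k))))
  (sym (trans (cong ((odd m ⊝ odd k) ⊛_) (r-vanishes m k m<k)) (*-zeroʳ (odd m ⊝ odd k))))

-- Induction on k, with `r-step` in both rows. Since aₘ + aₖ₊₁ = aₘ₊₁ + aₖ and aₘ₊₁ - aₖ₊₁ = aₘ -
-- aₖ, the factors agree once both sides are multiplied by the positive `odd (suc m) ⊕ odd k`.
r-shift : ∀ m k → r (suc m) k ⊛ (odd (suc m) ⊛ odd (suc m) ⊝ 1ℚ) ≡
                  r (suc (suc m)) k ⊛ (odd (suc m) ⊛ odd (suc m) ⊝ odd k ⊛ odd k)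
r-shift m zero    = refl
r-shift m (suc k) = *-cancelˡ (odd (suc m) ⊕ odd k) (+-mono-< (0<odd (suc m)) (0<odd k))
  (algebra (odd m) (odd (suc m)) (odd k) (odd (suc k)) (r (suc m) k) (r (suc (suc m)) k)
    (r (suc m) (suc k)) (r (suc (suc m)) (suc k))
    (odd-suc m) (odd-suc k) (r-step m k) (r-step (suc m) k) (r-shift m k))
  where
  algebra : ∀ b′ b c c′ x y x′ y′ → b ≡ b′ ⊕ 2ℚ → c′ ≡ c ⊕ 2ℚ →
    (b′ ⊕ c′) ⊛ x′ ≡ (b′ ⊝ c) ⊛ x → (b ⊕ c′) ⊛ y′ ≡ (b ⊝ c) ⊛ y →
    x ⊛ (b ⊛ b ⊝ 1ℚ) ≡ y ⊛ (b ⊛ b ⊝ c ⊛ c) →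
    (b ⊕ c) ⊛ (x′ ⊛ (b ⊛ b ⊝ 1ℚ)) ≡ (b ⊕ c) ⊛ (y′ ⊛ (b ⊛ b ⊝ c′ ⊛ c′))
  algebra b′ b c c′ x y x′ y′ refl refl h₁ h₂ h₃ =
    modulo₃ (b ⊛ b ⊝ 1ℚ) (- ((b ⊕ c) ⊛ (b′ ⊝ c))) (b′ ⊝ c) h₁ h₂ h₃
      (solve 6 (λ b′ c x y x′ y′ → let b = b′ :+ con 2ℚ ; c′ = c :+ con 2ℚ in
        (b :+ c) :* (x′ :* (b :* b :- con 1ℚ)) :=
        (b :+ c) :* (y′ :* (b :* b :- c′ :* c′))
          :+ (b :* b :- con 1ℚ) :* ((b′ :+ c′) :* x′ :- (b′ :- c) :* x)
          :+ (⊖ ((b :+ c) :* (b′ :- c))) :* ((b :+ c′) :* y′ :- (b :- c) :* y)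
          :+ (b′ :- c) :* (x :* (b :* b :- con 1ℚ) :- y :* (b :* b :- c :* c)))
        refl b′ c x y x′ y′)

-- The denominator is (2m+3)² - 1; C 0 = 0 makes w-shift hold at m = 0 as well.
C : ℕ → ℚ
C zero          = 0ℚ
C (suc zero)    = 1ℚ
C (suc (suc m)) = C (suc m) ⊛ ((+ (suc (2 * suc m) * suc (2 * suc m))) / suc (4 * m * m + 12 * m + 7))

-- For n ≥ 1, `C n` is the Wallis-type product of aⱼ² / (aⱼ² - 1) over 0 < j < n. Its denominators
-- are chosen to cancel the factor on the left of `r-shift`.
C-step : ∀ m → C (suc (suc m)) ⊛ (odd (suc m) ⊛ odd (suc m) ⊝ 1ℚ) ≡ C (suc m) ⊛ (odd (suc m) ⊛ odd (suc m))
C-step m = algebra (C (suc m)) (ι N) (ι (suc D)) ((+ N) / suc D) (odd (suc m) ⊛ odd (suc m))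
    (ι*/ N D) (sym (ι-* (suc (2 * suc m)) (suc (2 * suc m)))) (trans (cong ι (arith m)) (ι-+ 1 (suc D)))
  where
  N = suc (2 * suc m) * suc (2 * suc m)
  D = 4 * m * m + 12 * m + 7
  arith : ∀ m → suc (2 * suc m) * suc (2 * suc m) ≡ suc (suc (4 * m * m + 12 * m + 7))
  arith = solve-∀
  algebra : ∀ c n d q o → d ⊛ q ≡ n → o ≡ n → n ≡ 1ℚ ⊕ d → c ⊛ q ⊛ (o ⊝ 1ℚ) ≡ c ⊛ o
  algebra c n d q o h refl refl = modulo c h (solve 3 (λ c d q →
    c :* q :* (con 1ℚ :+ d :- con 1ℚ) := c :* (con 1ℚ :+ d) :+ c :* (d :* q :- (con 1ℚ :+ d))) refl c d q)

w : ℕ → ℕ → ℚ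
w n k = C n ⊛ r n k

w-step : ∀ m k → (odd m ⊕ odd (suc k)) ⊛ w (suc m) (suc k) ≡ (odd m ⊝ odd k) ⊛ w (suc m) k
w-step m k = algebra (odd m ⊕ odd (suc k)) (odd m ⊝ odd k) (C (suc m)) (r (suc m) (suc k)) (r (suc m) k) (r-step m k)
  where
  algebra : ∀ p q c x y → p ⊛ x ≡ q ⊛ y → p ⊛ (c ⊛ x) ≡ q ⊛ (c ⊛ y)
  algebra p q c x y h = modulo c h
    (solve 5 (λ p q c x y → p :* (c :* x) := q :* (c :* y) :+ c :* (p :* x :- q :* y)) refl p q c x y)

w-vanishes : ∀ m → w m m ≡ 0ℚ
w-vanishes zero    = refl
w-vanishes (suc m) = trans (cong (C (suc m) ⊛_) (r-vanishes m (suc m) (ℕ.n<1+n m))) (*-zeroʳ (C (suc m)))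

-- For m > 0 the factor aₘ² - 1 cancels between `C-step` and `r-shift`. In terms of partial
-- fractions, removing (1 - x²/aₘ²)⁻¹ from the product multiplies the residue at x = aₖ by 1 -
-- aₖ²/aₘ².
w-shift : ∀ m k → w m k ≡ w (suc m) k ⊛ (1ℚ ⊝ odd k ⊛ odd k ⊛ (u m ⊛ u m))
w-shift zero    zero    = refl
w-shift zero    (suc k) = trans (*-zeroˡ (r 0 (suc k)))
  (sym (trans (cong (λ z → 1ℚ ⊛ z ⊛ (1ℚ ⊝ odd (suc k) ⊛ odd (suc k) ⊛ 1ℚ)) (r-vanishes 0 (suc k) (s≤s z≤n)))
    (*-zeroˡ (1ℚ ⊝ odd (suc k) ⊛ odd (suc k) ⊛ 1ℚ))))
w-shift (suc m) k = algebra (C (suc m)) (C (suc (suc m))) (r (suc m) k) (r (suc (suc m)) k) (odd (suc m)) (u (suc m)) (odd k)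
    (C-step m) (r-shift m k) (odd*u (suc m))
  where
  algebra : ∀ c c′ x y b v o → c′ ⊛ (b ⊛ b ⊝ 1ℚ) ≡ c ⊛ (b ⊛ b) → x ⊛ (b ⊛ b ⊝ 1ℚ) ≡ y ⊛ (b ⊛ b ⊝ o ⊛ o) →
    b ⊛ v ≡ 1ℚ → c ⊛ x ≡ c′ ⊛ y ⊛ (1ℚ ⊝ o ⊛ o ⊛ (v ⊛ v))
  algebra c c′ x y b v o h₁ h₂ h₃ =
    modulo₃ (- (x ⊛ v ⊛ v)) (c′ ⊛ v ⊛ v) ((c′ ⊛ y ⊝ c ⊛ x) ⊛ (b ⊛ v ⊕ 1ℚ)) h₁ h₂ h₃
    (solve 7 (λ c c′ x y b v o → c :* x :=
      c′ :* y :* (con 1ℚ :- o :* o :* (v :* v))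
      :+ (⊖ (x :* v :* v)) :* (c′ :* (b :* b :- con 1ℚ) :- c :* (b :* b))
      :+ c′ :* v :* v :* (x :* (b :* b :- con 1ℚ) :- y :* (b :* b :- o :* o))
      :+ (c′ :* y :- c :* x) :* (b :* v :+ con 1ℚ) :* (b :* v :- con 1ℚ)) refl c c′ x y b v o)

-- The functional `Φ` and its summations by parts.

e : ℕ → ℚ
e k = alt k ⊛ u k

Φ : ℕ → (ℕ → ℚ) → ℚ
Φ n X = ∑ n λ k → w n k ⊛ (e k ⊛ X k)

-- `w-shift` expresses row m + 1 through row m; the extra summand k = m of row m is 0 by
-- `w-vanishes`. Thus the increment of `Φ` in n is again given by `Φ`, ready for comparison with the
-- increment of a star sum.
Φ-step : ∀ m Y → Φ (suc m) Y ≡ Φ m Y ⊕ u m ⊛ u m ⊛ Φ (suc m) (λ k → odd k ⊛ odd k ⊛ Y k)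
Φ-step m Y = begin
  Φ (suc m) Y
    ≡⟨ ∑-cong (suc m) (λ k → algebra (w m k) (w (suc m) k) (odd k ⊛ odd k) (u m ⊛ u m) (e k) (Y k) (w-shift m k)) ⟩
  ∑ (suc m) (λ k → w m k ⊛ (e k ⊛ Y k) ⊕ u m ⊛ u m ⊛ f k)
    ≡⟨ ∑-+ (suc m) (λ k → w m k ⊛ (e k ⊛ Y k)) (λ k → u m ⊛ u m ⊛ f k) ⟩
  Φ m Y ⊕ w m m ⊛ (e m ⊛ Y m) ⊕ ∑ (suc m) (λ k → u m ⊛ u m ⊛ f k)
    ≡⟨ cong₂ (λ x y → Φ m Y ⊕ x ⊛ (e m ⊛ Y m) ⊕ y) (w-vanishes m) (∑-* (suc m) (u m ⊛ u m) f) ⟩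
  Φ m Y ⊕ 0ℚ ⊛ (e m ⊛ Y m) ⊕ u m ⊛ u m ⊛ Φ (suc m) Y′
    ≡⟨ solve 3 (λ x y z → x :+ con 0ℚ :* y :+ z := x :+ z) refl (Φ m Y) (e m ⊛ Y m) (u m ⊛ u m ⊛ Φ (suc m) Y′) ⟩
  Φ m Y ⊕ u m ⊛ u m ⊛ Φ (suc m) Y′ ∎
  where
  open ≡-Reasoning
  Y′ f : ℕ → ℚ
  Y′ k = odd k ⊛ odd k ⊛ Y k
  f k = w (suc m) k ⊛ (e k ⊛ Y′ k)
  algebra : ∀ x x′ o v c y → x ≡ x′ ⊛ (1ℚ ⊝ o ⊛ v) → x′ ⊛ (c ⊛ y) ≡ x ⊛ (c ⊛ y) ⊕ v ⊛ (x′ ⊛ (c ⊛ (o ⊛ y)))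
  algebra x x′ o v c y refl = solve 5 (λ x′ o v c y →
    x′ :* (c :* y) := x′ :* (con 1ℚ :- o :* v) :* (c :* y) :+ v :* (x′ :* (c :* (o :* y)))) refl x′ o v c y

-- The factors `e k`, `odd k ⊛ odd k` and `u k` collapse to `alt k`. With v = `u m` and wₖ =
-- `w (suc m) k`, `w-step` reads (1 + v aₖ₊₁) wₖ₊₁ = (1 - v aₖ) wₖ, so (-1)ᵏ (1 + v aₖ) wₖ decreases
-- by 2 (-1)ᵏ wₖ from k to k + 1; this is summed by parts against `B`.
Φ-abel₃ : ∀ m U → let B = λ k → ∑ k (λ i → u i ⊛ u i ⊛ U i) in
  Φ (suc m) (λ k → odd k ⊛ odd k ⊛ (u k ⊛ (B k ⊕ B (suc k)))) ≡ u m ⊛ Φ (suc m) U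
Φ-abel₃ m U = trans (partial (suc m)) (trans
  (cong (λ z → v ⊛ Φ (suc m) U ⊝ alt (suc m) ⊛ z ⊛ (1ℚ ⊕ v ⊛ odd (suc m)) ⊛ B (suc m)) (w-vanishes (suc m)))
  (solve 4 (λ x a y b → x :- a :* con 0ℚ :* y :* b := x) refl (v ⊛ Φ (suc m) U) (alt (suc m)) (1ℚ ⊕ v ⊛ odd (suc m)) (B (suc m))))
  where
  v = u m
  B : ℕ → ℚ
  B k = ∑ k (λ i → u i ⊛ u i ⊛ U i)
  algebra : ∀ v b o o′ x y y′ a B U L S → o ⊛ x ≡ 1ℚ → (b ⊕ o′) ⊛ y′ ≡ (b ⊝ o) ⊛ y → b ⊛ v ≡ 1ℚ →
    L ≡ v ⊛ S ⊝ a ⊛ y ⊛ (1ℚ ⊕ v ⊛ o) ⊛ B →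
    L ⊕ y ⊛ (a ⊛ x ⊛ (o ⊛ o ⊛ (x ⊛ (B ⊕ (B ⊕ x ⊛ x ⊛ U))))) ≡
    v ⊛ (S ⊕ y ⊛ (a ⊛ x ⊛ U)) ⊝ (- a) ⊛ y′ ⊛ (1ℚ ⊕ v ⊛ o′) ⊛ (B ⊕ x ⊛ x ⊛ U)
  algebra v b o o′ x y y′ a B U L S h₁ h₂ h₃ refl = modulo₃
    (a ⊛ y ⊛ ((o ⊛ x ⊕ 1ℚ) ⊛ (B ⊕ β) ⊕ v ⊛ x ⊛ U)) (- (a ⊛ v ⊛ β)) (a ⊛ β ⊛ (y′ ⊝ y)) h₁ h₂ h₃
    (solve 11 (λ v b o o′ x y y′ a B U S → let β = B :+ x :* x :* U in
      v :* S :- a :* y :* (con 1ℚ :+ v :* o) :* B :+ y :* (a :* x :* (o :* o :* (x :* (B :+ β)))) :=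
      v :* (S :+ y :* (a :* x :* U)) :- (⊖ a) :* y′ :* (con 1ℚ :+ v :* o′) :* β
      :+ (a :* y :* ((o :* x :+ con 1ℚ) :* (B :+ β) :+ v :* x :* U)) :* (o :* x :- con 1ℚ)
      :+ (⊖ (a :* v :* β)) :* ((b :+ o′) :* y′ :- (b :- o) :* y)
      :+ (a :* β :* (y′ :- y)) :* (b :* v :- con 1ℚ)) refl v b o o′ x y y′ a B U S)
    where β = B ⊕ x ⊛ x ⊛ U
  -- The upper end j is free for the induction; at j = `suc m` the boundary term is 0 by
  -- `w-vanishes`.
  partial : ∀ j → ∑ j (λ k → w (suc m) k ⊛ (e k ⊛ (odd k ⊛ odd k ⊛ (u k ⊛ (B k ⊕ B (suc k)))))) ≡
    v ⊛ ∑ j (λ k → w (suc m) k ⊛ (e k ⊛ U k)) ⊝ alt j ⊛ w (suc m) j ⊛ (1ℚ ⊕ v ⊛ odd j) ⊛ B j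
  partial zero    = solve 3 (λ v x y → con 0ℚ := v :* con 0ℚ :- x :* y :* con 0ℚ) refl v (1ℚ ⊛ w (suc m) 0) (1ℚ ⊕ v ⊛ odd 0)
  partial (suc j) = algebra v (odd m) (odd j) (odd (suc j)) (u j) (w (suc m) j) (w (suc m) (suc j)) (alt j) (B j) (U j)
    (∑ j (λ k → w (suc m) k ⊛ (e k ⊛ (odd k ⊛ odd k ⊛ (u k ⊛ (B k ⊕ B (suc k)))))))
    (∑ j (λ k → w (suc m) k ⊛ (e k ⊛ U k)))
    (odd*u j) (w-step m j) (odd*u m) (partial j)

-- As in `Φ-abel₃`, but `alt k` removes the sign, so the primitive does not alternate: by `w-step`,
-- (aₘ + aₖ) wₖ decreases by 2 aₖ wₖ from k to k + 1.
Φ-abel₁ : ∀ m X → let D = λ k → ∑ k (λ i → e i ⊛ X i) in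
  Φ (suc m) (λ k → odd k ⊛ odd k ⊛ (alt k ⊛ (D k ⊕ D (suc k)))) ≡ odd m ⊛ Φ (suc m) X
Φ-abel₁ m X = trans (partial (suc m)) (trans
  (cong (λ z → odd m ⊛ Φ (suc m) X ⊝ z ⊛ (odd m ⊕ odd (suc m)) ⊛ D (suc m)) (w-vanishes (suc m)))
  (solve 3 (λ x y d → x :- con 0ℚ :* y :* d := x) refl (odd m ⊛ Φ (suc m) X) (odd m ⊕ odd (suc m)) (D (suc m))))
  where
  D : ℕ → ℚ
  D k = ∑ k (λ i → e i ⊛ X i)
  algebra : ∀ b o o′ x y y′ a D X L S → a ⊛ a ≡ 1ℚ → o ⊛ x ≡ 1ℚ → (b ⊕ o′) ⊛ y′ ≡ (b ⊝ o) ⊛ y →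
    L ≡ b ⊛ S ⊝ y ⊛ (b ⊕ o) ⊛ D →
    L ⊕ y ⊛ (a ⊛ x ⊛ (o ⊛ o ⊛ (a ⊛ (D ⊕ (D ⊕ a ⊛ x ⊛ X))))) ≡
    b ⊛ (S ⊕ y ⊛ (a ⊛ x ⊛ X)) ⊝ y′ ⊛ (b ⊕ o′) ⊛ (D ⊕ a ⊛ x ⊛ X)
  algebra b o o′ x y y′ a D X L S h₁ h₂ h₃ refl = modulo₃
    (y ⊛ x ⊛ o ⊛ o ⊛ (D ⊕ β)) (y ⊛ o ⊛ (D ⊕ β)) β h₁ h₂ h₃
    (solve 10 (λ b o o′ x y y′ a D X S → let β = D :+ a :* x :* X in
      b :* S :- y :* (b :+ o) :* D :+ y :* (a :* x :* (o :* o :* (a :* (D :+ β)))) :=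
      b :* (S :+ y :* (a :* x :* X)) :- y′ :* (b :+ o′) :* β
      :+ (y :* x :* o :* o :* (D :+ β)) :* (a :* a :- con 1ℚ)
      :+ (y :* o :* (D :+ β)) :* (o :* x :- con 1ℚ)
      :+ β :* ((b :+ o′) :* y′ :- (b :- o) :* y)) refl b o o′ x y y′ a D X S)
    where β = D ⊕ a ⊛ x ⊛ X
  partial : ∀ j → ∑ j (λ k → w (suc m) k ⊛ (e k ⊛ (odd k ⊛ odd k ⊛ (alt k ⊛ (D k ⊕ D (suc k)))))) ≡
    odd m ⊛ ∑ j (λ k → w (suc m) k ⊛ (e k ⊛ X k)) ⊝ w (suc m) j ⊛ (odd m ⊕ odd j) ⊛ D j
  partial zero    = solve 2 (λ v x → con 0ℚ := v :* con 0ℚ :- x :* con 0ℚ) refl (odd m) (w (suc m) 0 ⊛ (odd m ⊕ odd 0))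
  partial (suc j) = algebra (odd m) (odd j) (odd (suc j)) (u j) (w (suc m) j) (w (suc m) (suc j)) (alt j) (D j) (X j)
    (∑ j (λ k → w (suc m) k ⊛ (e k ⊛ (odd k ⊛ odd k ⊛ (alt k ⊛ (D k ⊕ D (suc k)))))))
    (∑ j (λ k → w (suc m) k ⊛ (e k ⊛ X k)))
    (alt² j) (odd*u j) (w-step m j) (partial j)

-- After multiplication by 2 (1 - aₙ), n = m + 1, the sum telescopes. The closed form vanishes at
-- the lower end because `odd 0` is 1, at the upper end because `w` does. In row 1 the factor would
-- be 0, and the sum there is 1.
Φ-odd² : ∀ m → Φ (suc (suc m)) (λ k → odd k ⊛ odd k ⊛ 1ℚ) ≡ 0ℚ
-- Since aₙ = aₘ + 2, this factor is -2 (1 - aₙ), written so that its positivity is visible.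
Φ-odd² m = *-cancelˡ (2ℚ ⊛ (1ℚ ⊕ odd m)) (*-pos (positive⁻¹ 2ℚ) (+-mono-< (positive⁻¹ 1ℚ) (0<odd m)))
  (conclude (odd m) (odd n) (odd (suc n)) (alt (suc n)) (w (suc n) (suc n)) (Φ (suc n) (λ k → odd k ⊛ odd k ⊛ 1ℚ))
    (odd-suc m) (w-vanishes (suc n)) (partial (suc n)))
  where
  n = suc m
  conclude : ∀ b′ b o a y S → b ≡ b′ ⊕ 2ℚ → y ≡ 0ℚ → 2ℚ ⊛ (1ℚ ⊝ b) ⊛ S ≡ a ⊛ (b ⊕ o) ⊛ (o ⊝ 1ℚ) ⊛ y →
    2ℚ ⊛ (1ℚ ⊕ b′) ⊛ S ≡ 2ℚ ⊛ (1ℚ ⊕ b′) ⊛ 0ℚ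
  conclude b′ b o a y S refl refl h = modulo (- 1ℚ) h
    (solve 4 (λ b′ o a S → con 2ℚ :* (con 1ℚ :+ b′) :* S := con 2ℚ :* (con 1ℚ :+ b′) :* con 0ℚ
      :+ con (- 1ℚ) :* (con 2ℚ :* (con 1ℚ :- (b′ :+ con 2ℚ)) :* S :- a :* (b′ :+ con 2ℚ :+ o) :* (o :- con 1ℚ) :* con 0ℚ))
      refl b′ o a S)
  algebra : ∀ b o o′ x y y′ a S → o′ ≡ o ⊕ 2ℚ → o ⊛ x ≡ 1ℚ → (b ⊕ o′) ⊛ y′ ≡ (b ⊝ o) ⊛ y →
    2ℚ ⊛ (1ℚ ⊝ b) ⊛ S ≡ a ⊛ (b ⊕ o) ⊛ (o ⊝ 1ℚ) ⊛ y →
    2ℚ ⊛ (1ℚ ⊝ b) ⊛ (S ⊕ y ⊛ (a ⊛ x ⊛ (o ⊛ o ⊛ 1ℚ))) ≡ (- a) ⊛ (b ⊕ o′) ⊛ (o′ ⊝ 1ℚ) ⊛ y′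
  algebra b o o′ x y y′ a S refl h₁ h₂ h₃ = modulo₃ (2ℚ ⊛ (1ℚ ⊝ b) ⊛ y ⊛ a ⊛ o) (a ⊛ (o ⊕ 1ℚ)) 1ℚ h₁ h₂ h₃
    (solve 7 (λ b o x y y′ a S → let o′ = o :+ con 2ℚ in
      con 2ℚ :* (con 1ℚ :- b) :* (S :+ y :* (a :* x :* (o :* o :* con 1ℚ))) :=
      (⊖ a) :* (b :+ o′) :* (o′ :- con 1ℚ) :* y′
      :+ con 2ℚ :* (con 1ℚ :- b) :* y :* a :* o :* (o :* x :- con 1ℚ)
      :+ a :* (o :+ con 1ℚ) :* ((b :+ o′) :* y′ :- (b :- o) :* y)
      :+ con 1ℚ :* (con 2ℚ :* (con 1ℚ :- b) :* S :- a :* (b :+ o) :* (o :- con 1ℚ) :* y)) refl b o x y y′ a S)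
  partial : ∀ j → 2ℚ ⊛ (1ℚ ⊝ odd n) ⊛ ∑ j (λ k → w (suc n) k ⊛ (e k ⊛ (odd k ⊛ odd k ⊛ 1ℚ))) ≡
    alt j ⊛ (odd n ⊕ odd j) ⊛ (odd j ⊝ 1ℚ) ⊛ w (suc n) j
  partial zero    = solve 3 (λ x y z → x :* con 0ℚ := y :* con 0ℚ :* z) refl (2ℚ ⊛ (1ℚ ⊝ odd n)) (1ℚ ⊛ (odd n ⊕ odd 0)) (w (suc n) 0)
  partial (suc j) = algebra (odd n) (odd j) (odd (suc j)) (u j) (w (suc n) j) (w (suc n) (suc j)) (alt j)
    (∑ j (λ k → w (suc n) k ⊛ (e k ⊛ (odd k ⊛ odd k ⊛ 1ℚ)))) (odd-suc j) (odd*u j) (w-step n j) (partial j)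

-- By `Φ-odd²` the increments after the first row vanish. This starts the representation at the
-- empty index and later ties `C` to Leibniz's series.
Φ-1 : ∀ m → Φ (suc m) (λ _ → 1ℚ) ≡ 1ℚ
Φ-1 zero    = refl
Φ-1 (suc m) = trans (Φ-step (suc m) (λ _ → 1ℚ))
  (trans (cong₂ (λ x y → x ⊕ u (suc m) ⊛ u (suc m) ⊛ y) (Φ-1 m) (Φ-odd² m))
    (solve 1 (λ x → con 1ℚ :+ x :* con 0ℚ := con 1ℚ) refl (u (suc m) ⊛ u (suc m))))

-- Truncated star sums as values of `Φ`.

pow : ℚ → ℕ → ℚ
pow x zero    = 1ℚ
pow x (suc n) = x ⊛ pow x n

pow-+ : ∀ x m n → pow x (m + n) ≡ pow x m ⊛ pow x n
pow-+ x zero    n = sym (*-identityˡ (pow x n))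
pow-+ x (suc m) n = trans (cong (x ⊛_) (pow-+ x m n)) (sym (*-assoc x (pow x m) (pow x n)))

1/-* : ∀ b d .{{_ : ℕ.NonZero b}} .{{_ : ℕ.NonZero d}} .{{_ : ℕ.NonZero (b * d)}} →
       (+ 1) / (b * d) ≡ ((+ 1) / b) ⊛ ((+ 1) / d)
1/-* (suc b) (suc d) = sym (/-* 1 b 1 d)

1/-^ : ∀ b s .{{_ : ℕ.NonZero b}} .{{_ : ℕ.NonZero (b ℕ.^ s)}} → (+ 1) / (b ℕ.^ s) ≡ pow ((+ 1) / b) s
1/-^ b zero    = refl
1/-^ b (suc s) = trans (1/-* b (b ℕ.^ s)) (cong (((+ 1) / b) ⊛_) (1/-^ b s))
  where
  instance
    bˢ≢0 : ℕ.NonZero (b ℕ.^ s)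
    bˢ≢0 = ℕ.m^n≢0 b s

term-plain : ∀ s i → term (plain s) i ≡ pow (u i) s
term-plain s i = trans (cong (λ z → z / (suc (2 * i) ℕ.^ s)) (ℤ.^-zeroˡ (suc i))) (1/-^ (suc (2 * i)) s)
  where
  instance
    bˢ≢0 : ℕ.NonZero (suc (2 * i) ℕ.^ s)
    bˢ≢0 = ℕ.m^n≢0 (suc (2 * i)) s

-- The sign has exponent `suc i` whereas `alt` starts at 1; this is the origin of the minus sign
-- common to all four t-values.
term-bar : ∀ s i → term (bar s) i ≡ - (alt i ⊛ pow (u i) s)
term-bar s i = trans (-1^/ (suc i) (suc (2 * i) ℕ.^ s))
  (trans (cong (- alt i ⊛_) (1/-^ (suc (2 * i)) s)) (sym (neg-distribˡ-* (alt i) (pow (u i) s))))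
  where
  instance
    bˢ≢0 : ℕ.NonZero (suc (2 * i) ℕ.^ s)
    bˢ≢0 = ℕ.m^n≢0 (suc (2 * i)) s

-- Only n ≥ 1: Φ 0 X = 0 while t⋆Sum [] 0 = 1.
Represents : List ℕ → (ℕ → ℚ) → Set
Represents ss X = ∀ m → t⋆Sum ss (suc m) ≡ Φ (suc m) X

-- The hypothesis equates the increment of `Φ` from `Φ-step` with that of the star sum, whose inner
-- sum is taken at `suc m` and so is covered by `Represents`. At n = 0 both sums are empty.
represents-∷ : ∀ {s ss X Y} → Represents ss X →
  (∀ m → u m ⊛ u m ⊛ Φ (suc m) (λ k → odd k ⊛ odd k ⊛ Y k) ≡ pow (u m) s ⊛ Φ (suc m) X) →
  Represents (s ∷ ss) Y
represents-∷ {s} {ss} {X} {Y} rep kernel m = go (suc m)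
  where
  go : ∀ n → t⋆Sum (s ∷ ss) n ≡ Φ n Y
  go zero    = refl
  go (suc n) = trans
    (cong₂ _⊕_ (go n) (trans (cong₂ _⊛_ (term-plain s n) (rep n)) (sym (kernel n))))
    (sym (Φ-step n Y))

represents-2∷ : ∀ {ss X} → Represents ss X → Represents (2 ∷ ss) (λ k → u k ⊛ u k ⊛ X k)
represents-2∷ {ss} {X} rep = represents-∷ {2} {ss} rep λ m → cong₂ _⊛_
  (cong (u m ⊛_) (sym (*-identityʳ (u m))))
  (∑-cong (suc m) λ k → cong (λ z → w (suc m) k ⊛ (e k ⊛ z)) (algebra (odd k) (u k) (X k) (odd*u k)))
  where
  algebra : ∀ o x y → o ⊛ x ≡ 1ℚ → o ⊛ o ⊛ (x ⊛ x ⊛ y) ≡ y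
  algebra o x y h = modulo ((o ⊛ x ⊕ 1ℚ) ⊛ y) h (solve 3 (λ o x y →
    o :* o :* (x :* x :* y) := y :+ (o :* x :+ con 1ℚ) :* y :* (o :* x :- con 1ℚ)) refl o x y)

represents-2s : ∀ a {ss X} → Represents ss X → Represents (replicate a 2 ++ ss) (λ k → pow (u k) (2 * a) ⊛ X k)
represents-2s zero    {ss} {X} rep m = trans (rep m) (∑-cong (suc m) λ k →
  cong (λ z → w (suc m) k ⊛ (e k ⊛ z)) (sym (*-identityˡ (X k))))
represents-2s (suc a) {ss} {X} rep m = trans (represents-2∷ {replicate a 2 ++ ss} (represents-2s a {ss} rep) m)
  (∑-cong (suc m) λ k → cong (λ z → w (suc m) k ⊛ (e k ⊛ z)) (trans
    (solve 3 (λ x p y → x :* x :* (p :* y) := x :* (x :* p) :* y) refl (u k) (pow (u k) (2 * a)) (X k))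
    (cong (λ z → pow (u k) z ⊛ X k) (sym (ℕ.*-suc 2 a)))))

-- The factor `u m` from `Φ-abel₃` raises the exponent 2 of `Φ-step` to 3; for `represents-1∷`,
-- `odd m` from `Φ-abel₁` lowers it to 1.
represents-3∷ : ∀ {ss U} → Represents ss U → let B = λ k → ∑ k (λ i → u i ⊛ u i ⊛ U i) in
  Represents (3 ∷ ss) (λ k → u k ⊛ (B k ⊕ B (suc k)))
represents-3∷ {ss} {U} rep = represents-∷ {3} {ss} rep λ m → trans
  (cong (u m ⊛ u m ⊛_) (Φ-abel₃ m U))
  (solve 2 (λ x y → x :* x :* (x :* y) := x :* (x :* (x :* con 1ℚ)) :* y) refl (u m) (Φ (suc m) U))

represents-1∷ : ∀ {ss X} → Represents ss X → let D = λ k → ∑ k (λ i → e i ⊛ X i) in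
  Represents (1 ∷ ss) (λ k → alt k ⊛ (D k ⊕ D (suc k)))
represents-1∷ {ss} {X} rep = represents-∷ {1} {ss} rep λ m → trans
  (cong (u m ⊛ u m ⊛_) (Φ-abel₁ m X))
  (algebra (odd m) (u m) (Φ (suc m) X) (odd*u m))
  where
  algebra : ∀ o x y → o ⊛ x ≡ 1ℚ → x ⊛ x ⊛ (o ⊛ y) ≡ x ⊛ 1ℚ ⊛ y
  algebra o x y h = modulo (x ⊛ y) h (solve 3 (λ o x y →
    x :* x :* (o :* y) := x :* con 1ℚ :* y :+ x :* y :* (o :* x :- con 1ℚ)) refl o x y)

represents-[] : Represents [] (λ _ → 1ℚ)
represents-[] m = sym (Φ-1 m)

-- Limits of weighted sums.

0≤ratio : ∀ n k → 0ℚ ℚ.≤ ratio n k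
0≤ratio n k = 0≤+/ (n ∸ suc k) (suc (n + k))

ratio≤1 : ∀ n k → ratio n k ℚ.≤ 1ℚ
ratio≤1 n k = /-≤ (n ∸ suc k) (suc (n + k)) 1 1 (subst₂ ℕ._≤_
  (sym (ℕ.*-identityʳ (n ∸ suc k))) (sym (ℕ.*-identityˡ (suc (n + k))))
  (ℕ.≤-trans (ℕ.m∸n≤m n (suc k)) (ℕ.m≤n⇒m≤1+n (ℕ.m≤m+n n k))))

0≤r : ∀ n k → 0ℚ ℚ.≤ r n k
0≤r n zero    = <⇒≤ (positive⁻¹ 1ℚ)
0≤r n (suc k) = *-nonNeg (0≤r n k) (0≤ratio n k)

r-anti : ∀ n k → r n (suc k) ℚ.≤ r n k
r-anti n k = subst (r n (suc k) ℚ.≤_) (*-identityʳ (r n k))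
  (*-monoˡ-≤-nonNeg (r n k) {{ℚ.nonNegative (0≤r n k)}} (ratio≤1 n k))

r≤1 : ∀ n k → r n k ℚ.≤ 1ℚ
r≤1 n zero    = ≤-refl
r≤1 n (suc k) = ≤-trans (r-anti n k) (r≤1 n k)

1-ratio≤ : ∀ n k → 1ℚ ⊝ ratio n k ℚ.≤ (+ (2 * suc k)) / suc n
1-ratio≤ n k = ≤-trans
  (subst (1ℚ ⊝ ratio n k ℚ.≤_)
    (solve 2 (λ a b → a :+ b :- a := b) refl (ratio n k) ((+ (2 * suc k)) / suc (n + k)))
    (+-monoˡ-≤ (- ratio n k) 1≤))
  (/-≤ (2 * suc k) (suc (n + k)) (2 * suc k) (suc n) (ℕ.*-monoʳ-≤ (2 * suc k) (s≤s (ℕ.m≤m+n n k))))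
  where
  N = n + k
  1≤ : 1ℚ ℚ.≤ ratio n k ⊕ (+ (2 * suc k)) / suc N
  1≤ = subst (1ℚ ℚ.≤_) (sym (/-+ (n ∸ suc k) N (2 * suc k) N))
    (/-≤ 1 1 ((n ∸ suc k) * suc N + 2 * suc k * suc N) (suc N * suc N)
      (subst₂ ℕ._≤_ (sym (ℕ.*-identityˡ (suc N * suc N)))
        (trans (ℕ.*-distribʳ-+ (suc N) (n ∸ suc k) (2 * suc k)) (sym (ℕ.*-identityʳ _)))
        (ℕ.*-monoˡ-≤ (suc N) (subst (ℕ._≤ n ∸ suc k + 2 * suc k) (ℕ.+-suc n k)
          (subst (n + suc k ℕ.≤_) (arith (n ∸ suc k) k)
            (ℕ.+-monoˡ-≤ (suc k) (subst (n ℕ.≤_) (ℕ.+-comm (suc k) (n ∸ suc k)) (ℕ.m≤n+m∸n n (suc k)))))))))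
    where
    arith : ∀ x k → x + suc k + suc k ≡ x + 2 * suc k
    arith = solve-∀

Null-/ : ∀ c → Null (λ n → (+ c) / suc n)
Null-/ c ε 0<ε with archimedean ε 0<ε
... | q , 1/q≤ε = c * suc q , λ n n≥ → ≤-trans
  (/-≤ c (suc n) 1 (suc q) (ℕ.≤-trans n≥ (ℕ.≤-trans (ℕ.n≤1+n n) (ℕ.≤-reflexive (sym (ℕ.*-identityˡ (suc n))))))) 1/q≤ε

Null-≤ : ∀ {x y : ℕ → ℚ} → (∀ n → x n ℚ.≤ y n) → Null y → Null x
Null-≤ x≤y y→0 ε 0<ε with y→0 ε 0<ε
... | N , h = N , λ n n≥ → ≤-trans (x≤y n) (h n n≥)

Null-+ : ∀ {x y : ℕ → ℚ} → Null x → Null y → Null (λ n → x n ⊕ y n)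
Null-+ {x} {y} x→0 y→0 ε 0<ε with x→0 (½ ⊛ ε) (0<½* 0<ε) | y→0 (½ ⊛ ε) (0<½* 0<ε)
... | M , hx | N , hy = M ℕ.⊔ N , λ n n≥ → subst (x n ⊕ y n ℚ.≤_) (½*p+½*p≡p ε)
  (+-mono-≤ (hx n (ℕ.≤-trans (ℕ.m≤m⊔n M N) n≥)) (hy n (ℕ.≤-trans (ℕ.m≤n⊔m M N) n≥)))

-- Induction on k through 1 - x q = (1 - x) + x (1 - q), with x = `r n k` ≤ 1 and q = `ratio n k`.
r→1 : ∀ k → Null (λ n → 1ℚ ⊝ r n k)
r→1 zero    = λ ε 0<ε → 0 , λ n _ → <⇒≤ 0<ε
r→1 (suc k) = Null-≤ {λ n → 1ℚ ⊝ r n (suc k)} {λ n → (1ℚ ⊝ r n k) ⊕ (+ (2 * suc k)) / suc n} bound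
  (Null-+ {λ n → 1ℚ ⊝ r n k} {λ n → (+ (2 * suc k)) / suc n} (r→1 k) (Null-/ (2 * suc k)))
  where
  bound : ∀ n → 1ℚ ⊝ r n (suc k) ℚ.≤ (1ℚ ⊝ r n k) ⊕ (+ (2 * suc k)) / suc n
  bound n = subst (ℚ._≤ (1ℚ ⊝ r n k) ⊕ (+ (2 * suc k)) / suc n)
    (solve 2 (λ x q → con 1ℚ :- x :+ x :* (con 1ℚ :- q) := con 1ℚ :- x :* q) refl (r n k) (ratio n k))
    (+-monoʳ-≤ (1ℚ ⊝ r n k) (≤-trans
      (subst (r n k ⊛ (1ℚ ⊝ ratio n k) ℚ.≤_) (*-identityˡ (1ℚ ⊝ ratio n k))
        (*-monoʳ-≤-nonNeg (1ℚ ⊝ ratio n k) {{ℚ.nonNegative (p≤q⇒0≤q-p (ratio≤1 n k))}} (r≤1 n k)))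
      (1-ratio≤ n k)))

∑-nonNeg : ∀ {f : ℕ → ℚ} → (∀ i → 0ℚ ℚ.≤ f i) → ∀ n → 0ℚ ℚ.≤ ∑ n f
∑-nonNeg 0≤f zero    = ≤-refl
∑-nonNeg {f} 0≤f (suc n) = +-nonNeg (∑-nonNeg {f} 0≤f n) (0≤f n)

f≤∑f : ∀ {f : ℕ → ℚ} → (∀ i → 0ℚ ℚ.≤ f i) → ∀ {n N} → n ℕ.< N → f n ℚ.≤ ∑ N f
f≤∑f {f} 0≤f {n} {suc N} (s≤s n≤N) with ℕ.m≤n⇒m<n∨m≡n n≤N
... | inj₁ n<N  = subst (ℚ._≤ ∑ N f ⊕ f N) (+-identityʳ (f n)) (+-mono-≤ (f≤∑f {f} 0≤f n<N) (0≤f N))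
... | inj₂ refl = subst (ℚ._≤ ∑ N f ⊕ f N) (+-identityˡ (f n)) (+-monoˡ-≤ (f N) (∑-nonNeg {f} 0≤f N))

Bounded : (ℕ → ℚ) → Set
Bounded x = Σ ℚ λ B → 0ℚ ℚ.< B × (∀ n → ∣ x n ∣ ℚ.≤ B)

-- `bounded` controls only a tail; the sum of the absolute values of the earlier terms accounts for
-- the rest.
cauchy⇒bounded : ∀ {x : ℕ → ℚ} → IsCauchy x → Bounded x
cauchy⇒bounded {x} cx = extend (bounded {x} cx)
  where
  extend : (Σ ℚ λ B → 0ℚ ℚ.< B × Σ ℕ λ N → ∀ n → N ℕ.≤ n → ∣ x n ∣ ℚ.≤ B) → Bounded x
  extend (B , 0<B , N , x≤B) = B ⊕ T , +-mono-<-≤ 0<B 0≤T , bound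
    where
    T = ∑ N (λ i → ∣ x i ∣)
    0≤T : 0ℚ ℚ.≤ T
    0≤T = ∑-nonNeg {λ i → ∣ x i ∣} (λ i → 0≤∣p∣ (x i)) N
    bound : ∀ n → ∣ x n ∣ ℚ.≤ B ⊕ T
    bound n with ℕ.≤-<-connex N n
    ... | inj₁ N≤n = subst (ℚ._≤ B ⊕ T) (+-identityʳ ∣ x n ∣) (+-mono-≤ (x≤B n N≤n) 0≤T)
    ... | inj₂ n<N = subst (ℚ._≤ B ⊕ T) (+-identityˡ ∣ x n ∣)
      (+-mono-≤ (<⇒≤ 0<B) (f≤∑f {λ i → ∣ x i ∣} (λ i → 0≤∣p∣ (x i)) n<N))

Null-bounded* : ∀ {x y : ℕ → ℚ} → Bounded y → Null (λ n → ∣ x n ∣) → Null (λ n → ∣ y n ⊛ x n ∣)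
Null-bounded* {x} {y} (B , 0<B , y≤B) x→0 = Null-≤ {λ n → ∣ y n ⊛ x n ∣} {λ n → B ⊛ ∣ x n ∣}
  (λ n → subst (ℚ._≤ B ⊛ ∣ x n ∣) (sym (∣p*q∣≡∣p∣*∣q∣ (y n) (x n)))
    (*-monoʳ-≤-nonNeg ∣ x n ∣ {{ℚ.nonNegative (0≤∣p∣ (x n))}} (y≤B n)))
  (Null-scale {B} {λ n → ∣ x n ∣} 0<B x→0)

Null-∣+∣ : ∀ {x y : ℕ → ℚ} → Null (λ n → ∣ x n ∣) → Null (λ n → ∣ y n ∣) → Null (λ n → ∣ x n ⊕ y n ∣)
Null-∣+∣ {x} {y} x→0 y→0 = Null-≤ {λ n → ∣ x n ⊕ y n ∣} {λ n → ∣ x n ∣ ⊕ ∣ y n ∣} (λ n → ∣p+q∣≤∣p∣+∣q∣ (x n) (y n))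
  (Null-+ {λ n → ∣ x n ∣} {λ n → ∣ y n ∣} x→0 y→0)

-- The difference of the weighted sum and c is an average of the Sₖ - c, Sₖ = ∑ k z,
-- with weights ω i - ω (suc i) ≥ 0.
module Abel (ω z : ℕ → ℚ) (ω₀ : ω 0 ≡ 1ℚ) (ω-anti : ∀ k → ω (suc k) ℚ.≤ ω k) (c : ℚ) where

  f : ℕ → ℚ
  f i = (ω i ⊝ ω (suc i)) ⊛ (∑ (suc i) z ⊝ c)

  summation-by-parts : ∀ j → ∑ j (λ k → ω k ⊛ z k) ≡ ω j ⊛ ∑ j z ⊕ (1ℚ ⊝ ω j) ⊛ c ⊕ ∑ j f
  summation-by-parts zero    = subst (λ y → 0ℚ ≡ y ⊛ 0ℚ ⊕ (1ℚ ⊝ y) ⊛ c ⊕ 0ℚ) (sym ω₀)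
    (solve 1 (λ c → con 0ℚ := con 1ℚ :* con 0ℚ :+ (con 1ℚ :- con 1ℚ) :* c :+ con 0ℚ) refl c)
  summation-by-parts (suc j) = trans (cong (_⊕ ω j ⊛ z j) (summation-by-parts j))
    (solve 6 (λ p p′ S y c F → p :* S :+ (con 1ℚ :- p) :* c :+ F :+ p :* y :=
      p′ :* (S :+ y) :+ (con 1ℚ :- p′) :* c :+ (F :+ (p :- p′) :* (S :+ y :- c))) refl
      (ω j) (ω (suc j)) (∑ j z) (z j) c (∑ j f))

  ∣f∣≤ : ∀ i {B} → ∣ ∑ (suc i) z ⊝ c ∣ ℚ.≤ B → ∣ f i ∣ ℚ.≤ (ω i ⊝ ω (suc i)) ⊛ B
  ∣f∣≤ i {B} S≤B = subst (ℚ._≤ (ω i ⊝ ω (suc i)) ⊛ B)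
    (sym (trans (∣p*q∣≡∣p∣*∣q∣ (ω i ⊝ ω (suc i)) (∑ (suc i) z ⊝ c)) (cong (_⊛ ∣ ∑ (suc i) z ⊝ c ∣) (0≤p⇒∣p∣≡p 0≤d))))
    (*-monoˡ-≤-nonNeg (ω i ⊝ ω (suc i)) {{ℚ.nonNegative 0≤d}} S≤B)
    where
    0≤d : 0ℚ ℚ.≤ ω i ⊝ ω (suc i)
    0≤d = p≤q⇒0≤q-p (ω-anti i)

  -- The weights in `f` telescope: those before N total 1 - `ω N` and meet the crude bound `B`,
  -- those from N on total `ω N ⊝ ω (k + N)` and meet the fine bound `η`.
  bound : ∀ {B η N} → (∀ i → ∣ ∑ (suc i) z ⊝ c ∣ ℚ.≤ B) → (∀ i → N ℕ.≤ i → ∣ ∑ (suc i) z ⊝ c ∣ ℚ.≤ η) →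
          ∀ k → ∣ ∑ (k + N) f ∣ ℚ.≤ B ⊛ (1ℚ ⊝ ω N) ⊕ η ⊛ (ω N ⊝ ω (k + N))
  bound {B} {η} {N} ≤B ≤η zero = subst (∣ ∑ N f ∣ ℚ.≤_)
    (trans (cong (λ y → - (B ⊛ ω N) ⊝ - (B ⊛ y)) ω₀)
      (solve 3 (λ b x h → (⊖ (b :* x)) :- (⊖ (b :* con 1ℚ)) := b :* (con 1ℚ :- x) :+ h :* (x :- x)) refl B (ω N) η))
    (∑-bound {f} (λ i → - (B ⊛ ω i)) (λ i → subst (∣ f i ∣ ℚ.≤_)
      (solve 3 (λ b x y → (x :- y) :* b := (⊖ (b :* y)) :- (⊖ (b :* x))) refl B (ω i) (ω (suc i)))
      (∣f∣≤ i (≤B i))) N)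
  bound {B} {η} {N} ≤B ≤η (suc k) = ≤-trans (∣p+q∣≤∣p∣+∣q∣ (∑ (k + N) f) (f (k + N)))
    (subst (∣ ∑ (k + N) f ∣ ⊕ ∣ f (k + N) ∣ ℚ.≤_)
      (solve 5 (λ b x y y′ h → b :* (con 1ℚ :- x) :+ h :* (x :- y) :+ (y :- y′) :* h :=
        b :* (con 1ℚ :- x) :+ h :* (x :- y′)) refl B (ω N) (ω (k + N)) (ω (suc k + N)) η)
      (+-mono-≤ (bound {B} {η} {N} ≤B ≤η k) (∣f∣≤ (k + N) (≤η (k + N) (ℕ.m≤n+m N k)))))


  ∣weighted-sum-c∣≤ : ∀ {B η N} → (∀ i → ∣ ∑ (suc i) z ⊝ c ∣ ℚ.≤ B) → (∀ i → N ℕ.≤ i → ∣ ∑ (suc i) z ⊝ c ∣ ℚ.≤ η) →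
    0ℚ ℚ.≤ η → ω N ℚ.≤ 1ℚ → ∀ n → N ℕ.≤ n → ω n ≡ 0ℚ →
    ∣ ∑ n (λ k → ω k ⊛ z k) ⊝ c ∣ ℚ.≤ B ⊛ (1ℚ ⊝ ω N) ⊕ η
  ∣weighted-sum-c∣≤ {B} {η} {N} ≤B ≤η 0≤η ωN≤1 n N≤n ωn≡0 = subst (λ y → ∣ y ∣ ℚ.≤ B ⊛ (1ℚ ⊝ ω N) ⊕ η) (sym eq)
    (≤-trans f≤ (+-monoʳ-≤ (B ⊛ (1ℚ ⊝ ω N)) η≤))
    where
    eq : ∑ n (λ k → ω k ⊛ z k) ⊝ c ≡ ∑ n f
    eq = trans (cong (_⊝ c) (summation-by-parts n))
      (trans (cong (λ y → y ⊛ ∑ n z ⊕ (1ℚ ⊝ y) ⊛ c ⊕ ∑ n f ⊝ c) ωn≡0)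
        (solve 3 (λ c F S → con 0ℚ :* S :+ (con 1ℚ :- con 0ℚ) :* c :+ F :- c := F) refl c (∑ n f) (∑ n z)))
    f≤ : ∣ ∑ n f ∣ ℚ.≤ B ⊛ (1ℚ ⊝ ω N) ⊕ η ⊛ (ω N ⊝ ω n)
    f≤ = subst (λ j → ∣ ∑ j f ∣ ℚ.≤ B ⊛ (1ℚ ⊝ ω N) ⊕ η ⊛ (ω N ⊝ ω j)) (ℕ.m∸n+n≡m N≤n)
      (bound {B} {η} {N} ≤B ≤η (n ∸ N))
    η≤ : η ⊛ (ω N ⊝ ω n) ℚ.≤ η
    η≤ = subst (η ⊛ (ω N ⊝ ω n) ℚ.≤_) (*-identityʳ η)
      (*-monoˡ-≤-nonNeg η {{ℚ.nonNegative 0≤η}} (≤-trans (p-q≤p (ω N) (≤-reflexive (sym ωn≡0))) ωN≤1))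

-- `Abel` is applied with c = `∑ n z`, which varies with n. First N is chosen by the Cauchy
-- property, making the later deviations small; then K by `r→1` at this fixed N, making the total
-- weight before N small.
r-sum→sum : ∀ (z : ℕ → ℚ) → IsCauchy (λ n → ∑ n z) → Null (λ n → ∣ ∑ n (λ k → r n k ⊛ z k) ⊝ ∑ n z ∣)
r-sum→sum z cz ε 0<ε = choose-N (cauchy⇒bounded {λ n → ∑ n z} cz) (cz (½ ⊛ ε) (0<½* 0<ε))
  where
  Goal : Set
  Goal = Σ ℕ λ N → ∀ n → N ℕ.≤ n → ∣ ∑ n (λ k → r n k ⊛ z k) ⊝ ∑ n z ∣ ℚ.≤ ε
  choose-N : Bounded (λ n → ∑ n z) → (Σ ℕ λ N → ∀ m n → N ℕ.≤ m → N ℕ.≤ n → ∣ ∑ m z ⊝ ∑ n z ∣ ℚ.≤ ½ ⊛ ε) → Goal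
  choose-N (M , 0<M , S≤M) (N , close) =
    choose-K (Null-scale {M ⊕ M} {λ n → 1ℚ ⊝ r n N} (+-mono-< 0<M 0<M) (r→1 N) (½ ⊛ ε) (0<½* 0<ε))
    where
    ≤2M : ∀ n i → ∣ ∑ (suc i) z ⊝ ∑ n z ∣ ℚ.≤ M ⊕ M
    ≤2M n i = ≤-trans (∣p+q∣≤∣p∣+∣q∣ (∑ (suc i) z) (- ∑ n z))
      (+-mono-≤ (S≤M (suc i)) (subst (ℚ._≤ M) (sym (∣-p∣≡∣p∣ (∑ n z))) (S≤M n)))
    estimate : ∀ n → N ℕ.≤ n → r n n ≡ 0ℚ →
      ∣ ∑ n (λ k → r n k ⊛ z k) ⊝ ∑ n z ∣ ℚ.≤ (M ⊕ M) ⊛ (1ℚ ⊝ r n N) ⊕ ½ ⊛ ε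
    estimate n N≤n = Abel.∣weighted-sum-c∣≤ (r n) z refl (r-anti n) (∑ n z)
      {M ⊕ M} {½ ⊛ ε} {N} (≤2M n) (λ i N≤i → close (suc i) n (ℕ.m≤n⇒m≤1+n N≤i) N≤n)
      (<⇒≤ (0<½* 0<ε)) (r≤1 n N) n N≤n
    vanish : ∀ {n} → 0 ℕ.< n → r n n ≡ 0ℚ
    vanish {suc m} _ = r-vanishes m (suc m) (ℕ.n<1+n m)
    choose-K : (Σ ℕ λ K → ∀ n → K ℕ.≤ n → (M ⊕ M) ⊛ (1ℚ ⊝ r n N) ℚ.≤ ½ ⊛ ε) → Goal
    -- The `suc` excludes n = 0, where `r n n` is 1.
    choose-K (K , small) = suc (N ℕ.⊔ K) , λ n n≥ → let n≥′ = ℕ.<⇒≤ n≥ in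
      subst (∣ ∑ n (λ k → r n k ⊛ z k) ⊝ ∑ n z ∣ ℚ.≤_) (½*p+½*p≡p ε)
        (≤-trans (estimate n (ℕ.≤-trans (ℕ.m≤m⊔n N K) n≥′) (vanish (ℕ.≤-<-trans z≤n n≥)))
          (+-monoˡ-≤ (½ ⊛ ε) (small n (ℕ.≤-trans (ℕ.m≤n⊔m N K) n≥′))))

-- The constant 4/π and the limit of a represented star sum.

-- Here `v` and `p` are approximants of π, `P` and `Q` the weighted sums of Leibniz's series and of
-- the target series `y`. The error x - 4iy equals i (x (v - p) - x (P - p) + 4 (Q - y)), made of
-- bounded factors times null sequences.
quotient-limit : ∀ {x v p P Q y i : ℕ → ℚ} → (∀ n → i n ⊛ v n ≡ 1ℚ) → Bounded x → Bounded i →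
  Null (λ n → ∣ v n ⊝ p n ∣) → Null (λ n → ∣ P n ⊝ p n ∣) →
  (∀ m → x (suc m) ⊛ P (suc m) ≡ 4ℚ ⊛ Q (suc m)) → Null (λ n → ∣ Q n ⊝ y n ∣) →
  Null (λ n → ∣ x n ⊝ 4ℚ ⊛ i n ⊛ y n ∣)
quotient-limit {x} {v} {p} {P} {Q} {y} {i} iv≡1 bx bi vp Pp xP Qy ε 0<ε = shift (decomposed ε 0<ε)
  where
  E : ℕ → ℚ
  E n = i n ⊛ (x n ⊛ (v n ⊝ p n) ⊕ ((- x n) ⊛ (P n ⊝ p n) ⊕ 4ℚ ⊛ (Q n ⊝ y n)))
  b-x : Bounded (λ n → - x n)
  b-x = proj₁ bx , proj₁ (proj₂ bx) , λ n → subst (ℚ._≤ proj₁ bx) (sym (∣-p∣≡∣p∣ (x n))) (proj₂ (proj₂ bx) n)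
  decomposed : Null (λ n → ∣ E n ∣)
  decomposed = Null-bounded* {λ n → x n ⊛ (v n ⊝ p n) ⊕ ((- x n) ⊛ (P n ⊝ p n) ⊕ 4ℚ ⊛ (Q n ⊝ y n))} {i} bi
    (Null-∣+∣ {λ n → x n ⊛ (v n ⊝ p n)} {λ n → (- x n) ⊛ (P n ⊝ p n) ⊕ 4ℚ ⊛ (Q n ⊝ y n)}
      (Null-bounded* {λ n → v n ⊝ p n} {x} bx vp)
      (Null-∣+∣ {λ n → (- x n) ⊛ (P n ⊝ p n)} {λ n → 4ℚ ⊛ (Q n ⊝ y n)}
        (Null-bounded* {λ n → P n ⊝ p n} {λ n → - x n} b-x Pp)
        (Null-bounded* {λ n → Q n ⊝ y n} {λ _ → 4ℚ} (4ℚ , positive⁻¹ 4ℚ , λ _ → ≤-refl) Qy)))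
  algebra : ∀ x v p P Q y i → i ⊛ v ≡ 1ℚ → x ⊛ P ≡ 4ℚ ⊛ Q →
    i ⊛ (x ⊛ (v ⊝ p) ⊕ ((- x) ⊛ (P ⊝ p) ⊕ 4ℚ ⊛ (Q ⊝ y))) ≡ x ⊝ 4ℚ ⊛ i ⊛ y
  algebra x v p P Q y i h₁ h₂ = modulo₂ x (- i) h₁ h₂ (solve 7 (λ x v p P Q y i →
    i :* (x :* (v :- p) :+ ((⊖ x) :* (P :- p) :+ con 4ℚ :* (Q :- y))) :=
    x :- con 4ℚ :* i :* y :+ x :* (i :* v :- con 1ℚ) :+ (⊖ i) :* (x :* P :- con 4ℚ :* Q)) refl x v p P Q y i)
  shift : (Σ ℕ λ N → ∀ n → N ℕ.≤ n → ∣ E n ∣ ℚ.≤ ε) → Σ ℕ λ N → ∀ n → N ℕ.≤ n → ∣ x n ⊝ 4ℚ ⊛ i n ⊛ y n ∣ ℚ.≤ ε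
  shift (N , small) = suc N , λ where
    (suc m) n≥ → subst (λ z → ∣ z ∣ ℚ.≤ ε)
      (algebra (x (suc m)) (v (suc m)) (p (suc m)) (P (suc m)) (Q (suc m)) (y (suc m)) (i (suc m)) (iv≡1 (suc m)) (xP m))
      (small (suc m) (ℕ.<⇒≤ n≥))

represents⇒limit : ∀ (x y : ℝ) (Z : ℕ → ℚ) → (∀ m → seq x (suc m) ≡ Φ (suc m) Z) →
  (∀ n → ∑ n (λ k → e k ⊛ Z k) ≡ seq y n) → x ≃ᴿ 4 /π *ᴿ y
represents⇒limit x y Z rep sum≡y = quotient-limit
  -- `reciprocal π π>0` inverts the terms from index 2 on, so its approximants of π are shifted
  -- against `πSum`.
  {seq x} {λ n → πSum (n + 2)} {πSum} {P} {Q} {seq y} {seq (reciprocal π π>0)}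
  (λ n → *-inverseˡ (πSum (n + 2)) {{Positiveᴿ.seq≢0 π>0 n}})
  (cauchy⇒bounded {seq x} (cauchy x))
  (cauchy⇒bounded {seq (reciprocal π π>0)} (cauchy (reciprocal π π>0)))
  (λ ε 0<ε → let N , close = πSum-cauchy ε 0<ε in N , λ n n≥ → close (n + 2) n (ℕ.m≤n⇒m≤n+o 2 n≥) n≥)
  (r-sum→sum πterm πSum-cauchy)
  -- `C` is eliminated here: C R = 1 by `Φ-1`, and P = 4 R.
  (λ m → trans (cong₂ _⊛_ (trans (rep m) (C-out (suc m) Z)) (P≡ (suc m)))
    (algebra (C (suc m)) (Q (suc m)) (R (suc m)) (trans (sym (C-out (suc m) (λ _ → 1ℚ))) (Φ-1 m))))
  (λ ε 0<ε → let N , small = Q→sum ε 0<ε in N , λ n n≥ →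
    subst (λ z → ∣ Q n ⊝ z ∣ ℚ.≤ ε) (sum≡y n) (small n n≥))
  where
  πterm : ℕ → ℚ
  πterm k = 4ℚ ⊛ ((-1ℤ ℤ.^ k) / suc (2 * k))
  P Q R : ℕ → ℚ
  P n = ∑ n (λ k → r n k ⊛ πterm k)
  Q n = ∑ n (λ k → r n k ⊛ (e k ⊛ Z k))
  R n = ∑ n (λ k → r n k ⊛ (e k ⊛ 1ℚ))
  C-out : ∀ n X → Φ n X ≡ C n ⊛ ∑ n (λ k → r n k ⊛ (e k ⊛ X k))
  C-out n X = trans (∑-cong n (λ k → *-assoc (C n) (r n k) (e k ⊛ X k))) (∑-* n (C n) (λ k → r n k ⊛ (e k ⊛ X k)))
  P≡ : ∀ n → P n ≡ 4ℚ ⊛ R n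
  P≡ n = trans (∑-cong n (λ k → trans (cong (λ z → r n k ⊛ (4ℚ ⊛ z)) (-1^/ k (suc (2 * k))))
      (solve 2 (λ x y → x :* (con 4ℚ :* y) := con 4ℚ :* (x :* (y :* con 1ℚ))) refl (r n k) (e k))))
    (∑-* n 4ℚ (λ k → r n k ⊛ (e k ⊛ 1ℚ)))
  algebra : ∀ c q s → c ⊛ s ≡ 1ℚ → c ⊛ q ⊛ (4ℚ ⊛ s) ≡ 4ℚ ⊛ q
  algebra c q s h = modulo (4ℚ ⊛ q) h (solve 3 (λ c q s →
    c :* q :* (con 4ℚ :* s) := con 4ℚ :* q :+ con 4ℚ :* q :* (c :* s :- con 1ℚ)) refl c q s)
  Q→sum : Null (λ n → ∣ Q n ⊝ ∑ n (λ k → e k ⊛ Z k) ∣)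
  Q→sum = r-sum→sum (λ k → e k ⊛ Z k) λ ε 0<ε → let N , close = cauchy y ε 0<ε in N , λ m n m≥ n≥ →
    subst₂ (λ a b → ∣ a ⊝ b ∣ ℚ.≤ ε) (sym (sum≡y m)) (sym (sum≡y n)) (close m n m≥ n≥)

4-term-limit : ∀ (x t₁ t₂ t₃ t₄ : ℝ) (Z : ℕ → ℚ) → (∀ m → seq x (suc m) ≡ Φ (suc m) Z) →
  (∀ n → ∑ n (λ k → e k ⊛ Z k) ≡ - (seq t₁ n ⊕ 2ℚ ⊛ seq t₂ n ⊕ 2ℚ ⊛ seq t₃ n ⊕ 4ℚ ⊛ seq t₄ n)) →
  x ≃ᴿ -ᴿ (4 /π) *ᴿ t₁ -ᴿ 8 /π *ᴿ t₂ -ᴿ 8 /π *ᴿ t₃ -ᴿ 16 /π *ᴿ t₄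
4-term-limit x t₁ t₂ t₃ t₄ Z rep sum≡ ε 0<ε =
  -- `seq` of this combination computes to the right side of `sum≡`; the factor 4/π turns the
  -- coefficients 1, 2, 2, 4 into 4, 8, 8, 16.
  let N , small = represents⇒limit x (-ᴿ (t₁ +ᴿ fromℚ 2ℚ *ᴿ t₂ +ᴿ fromℚ 2ℚ *ᴿ t₃ +ᴿ fromℚ 4ℚ *ᴿ t₄)) Z rep sum≡ ε 0<ε
  in N , λ n n≥ → subst (λ z → ∣ seq x n ⊝ z ∣ ℚ.≤ ε)
    (algebra (seq (reciprocal π π>0) n) (seq t₁ n) (seq t₂ n) (seq t₃ n) (seq t₄ n)) (small n n≥)
  where
  algebra : ∀ i a b c d → 4ℚ ⊛ i ⊛ (- (a ⊕ 2ℚ ⊛ b ⊕ 2ℚ ⊛ c ⊕ 4ℚ ⊛ d)) ≡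
    (- (4ℚ ⊛ i)) ⊛ a ⊕ (- (ι 8 ⊛ i ⊛ b)) ⊕ (- (ι 8 ⊛ i ⊛ c)) ⊕ (- (ι 16 ⊛ i ⊛ d))
  algebra = solve 5 (λ i a b c d →
    con 4ℚ :* i :* (⊖ (a :+ con 2ℚ :* b :+ con 2ℚ :* c :+ con 4ℚ :* d)) :=
    (⊖ (con 4ℚ :* i)) :* a :+ (⊖ (con (ι 8) :* i :* b)) :+ (⊖ (con (ι 8) :* i :* c)) :+ (⊖ (con (ι 16) :* i :* d))) refl

-- Expansion into alternating multiple t-values.

∑-2-terms : ∀ n (f g : ℕ → ℚ) → ∑ n (λ k → f k ⊕ 2ℚ ⊛ g k) ≡ ∑ n f ⊕ 2ℚ ⊛ ∑ n g
∑-2-terms n f g = trans (∑-+ n f (λ k → 2ℚ ⊛ g k)) (cong (∑ n f ⊕_) (∑-* n 2ℚ g))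

∑-4-terms : ∀ n (f₁ f₂ f₃ f₄ : ℕ → ℚ) →
  ∑ n (λ k → - (f₁ k ⊕ 2ℚ ⊛ f₂ k ⊕ 2ℚ ⊛ f₃ k ⊕ 4ℚ ⊛ f₄ k)) ≡
  - (∑ n f₁ ⊕ 2ℚ ⊛ ∑ n f₂ ⊕ 2ℚ ⊛ ∑ n f₃ ⊕ 4ℚ ⊛ ∑ n f₄)
∑-4-terms zero    f₁ f₂ f₃ f₄ = refl
∑-4-terms (suc n) f₁ f₂ f₃ f₄ = trans
  (cong (_⊕ - (f₁ n ⊕ 2ℚ ⊛ f₂ n ⊕ 2ℚ ⊛ f₃ n ⊕ 4ℚ ⊛ f₄ n)) (∑-4-terms n f₁ f₂ f₃ f₄))
  (solve 8 (λ a b c d a′ b′ c′ d′ →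
    (⊖ (a :+ con 2ℚ :* b :+ con 2ℚ :* c :+ con 4ℚ :* d)) :+ (⊖ (a′ :+ con 2ℚ :* b′ :+ con 2ℚ :* c′ :+ con 4ℚ :* d′)) :=
    ⊖ ((a :+ a′) :+ con 2ℚ :* (b :+ b′) :+ con 2ℚ :* (c :+ c′) :+ con 4ℚ :* (d :+ d′))) refl
    (∑ n f₁) (∑ n f₂) (∑ n f₃) (∑ n f₄) (f₁ n) (f₂ n) (f₃ n) (f₄ n))

represents-final-2s : ∀ c → Represents (replicate c 2) (λ k → pow (u k) (2 * c) ⊛ 1ℚ)
represents-final-2s c = subst (λ ss → Represents ss (λ k → pow (u k) (2 * c) ⊛ 1ℚ)) (++-identityʳ (replicate c 2))
  (represents-2s c {[]} represents-[])

pow-+-+ : ∀ x a b c → pow x (a + b + c) ≡ pow x a ⊛ pow x b ⊛ pow x c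
pow-+-+ x a b c = trans (pow-+ x (a + b) c) (cong (_⊛ pow x c) (pow-+ x a b))

module Expansion₁ (a b c : ℕ) where

  D U B Z : ℕ → ℚ
  D k = ∑ k (λ i → e i ⊛ (pow (u i) (2 * c) ⊛ 1ℚ))
  U k = pow (u k) (2 * b) ⊛ (alt k ⊛ (D k ⊕ D (suc k)))
  B k = ∑ k (λ i → u i ⊛ u i ⊛ U i)
  Z k = pow (u k) (2 * a) ⊛ (u k ⊛ (B k ⊕ B (suc k)))

  represents : Represents (replicate a 2 ++ 3 ∷ replicate b 2 ++ 1 ∷ replicate c 2) Z
  represents = represents-2s a {3 ∷ replicate b 2 ++ 1 ∷ replicate c 2}
    (represents-3∷ {replicate b 2 ++ 1 ∷ replicate c 2}
    (represents-2s b {1 ∷ replicate c 2} (represents-1∷ {replicate c 2} (represents-final-2s c))))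

  D≡ : ∀ k → D k ≡ - 1ℚ ⊛ tSum (bar (1 + 2 * c) ∷ []) k
  D≡ k = trans (∑-cong k λ i → algebra (alt i) (u i) (pow (u i) (2 * c)) _ (term-bar (1 + 2 * c) i))
    (∑-* k (- 1ℚ) (λ i → term (bar (1 + 2 * c)) i ⊛ 1ℚ))
    where
    algebra : ∀ s x p τ → τ ≡ - (s ⊛ (x ⊛ p)) → s ⊛ x ⊛ (p ⊛ 1ℚ) ≡ - 1ℚ ⊛ (τ ⊛ 1ℚ)
    algebra s x p τ refl = solve 3 (λ s x p → s :* x :* (p :* con 1ℚ) :=
      con (- 1ℚ) :* ((⊖ (s :* (x :* p))) :* con 1ℚ)) refl s x p

  -- `D k ⊕ D (suc k)` is twice the strict sum `D k` plus the diagonal summand. The strict part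
  -- gives the double sum with coefficient 2; the diagonal part merges the exponents, and its two
  -- signs cancel by `alt²`.
  B≡ : ∀ k → B k ≡ tSum (plain (3 + 2 * b + 2 * c) ∷ []) k ⊕ 2ℚ ⊛ tSum (bar (2 + 2 * b) ∷ bar (1 + 2 * c) ∷ []) k
  B≡ k = trans (∑-cong k λ i → algebra (alt i) (u i) (pow (u i) (2 * b)) (pow (u i) (2 * c))
        (pow (u i) (2 * b + 2 * c)) (D i) (tSum (bar (1 + 2 * c) ∷ []) i)
        (term (plain (3 + 2 * b + 2 * c)) i) (term (bar (2 + 2 * b)) i)
        (alt² i) (pow-+ (u i) (2 * b) (2 * c)) (D≡ i) (term-plain (3 + 2 * b + 2 * c) i) (term-bar (2 + 2 * b) i))
    (∑-2-terms k (λ i → term (plain (3 + 2 * b + 2 * c)) i ⊛ 1ℚ)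
      (λ i → term (bar (2 + 2 * b)) i ⊛ tSum (bar (1 + 2 * c) ∷ []) i))
    where
    algebra : ∀ s x pb pc pbc d T τ₁ τ₂ → s ⊛ s ≡ 1ℚ → pbc ≡ pb ⊛ pc → d ≡ - 1ℚ ⊛ T →
      τ₁ ≡ x ⊛ (x ⊛ (x ⊛ pbc)) → τ₂ ≡ - (s ⊛ (x ⊛ (x ⊛ pb))) →
      x ⊛ x ⊛ (pb ⊛ (s ⊛ (d ⊕ (d ⊕ s ⊛ x ⊛ (pc ⊛ 1ℚ))))) ≡ τ₁ ⊛ 1ℚ ⊕ 2ℚ ⊛ (τ₂ ⊛ T)
    algebra s x pb pc pbc d T τ₁ τ₂ h refl refl refl refl = modulo (x ⊛ x ⊛ x ⊛ pb ⊛ pc) h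
      (solve 5 (λ s x pb pc T → let d = con (- 1ℚ) :* T in
        x :* x :* (pb :* (s :* (d :+ (d :+ s :* x :* (pc :* con 1ℚ))))) :=
        x :* (x :* (x :* (pb :* pc))) :* con 1ℚ :+ con 2ℚ :* ((⊖ (s :* (x :* (x :* pb)))) :* T)
        :+ x :* x :* x :* pb :* pc :* (s :* s :- con 1ℚ)) refl s x pb pc T)

  -- Strict or diagonal at each of two places gives four terms with coefficients 1, 2, 2, 4. An
  -- entry is barred exactly when an odd number of the three factors `alt`, from `e k`, `U` and `D`,
  -- merge into it.
  sum≡ : ∀ n → ∑ n (λ k → e k ⊛ Z k) ≡
    - (tSum (bar (5 + 2 * a + 2 * b + 2 * c) ∷ []) n
      ⊕ 2ℚ ⊛ tSum (bar (2 + 2 * a) ∷ plain (3 + 2 * b + 2 * c) ∷ []) n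
      ⊕ 2ℚ ⊛ tSum (plain (4 + 2 * a + 2 * b) ∷ bar (1 + 2 * c) ∷ []) n
      ⊕ 4ℚ ⊛ tSum (bar (2 + 2 * a) ∷ bar (2 + 2 * b) ∷ bar (1 + 2 * c) ∷ []) n)
  sum≡ n = trans (∑-cong n λ k → algebra (alt k) (u k) (pow (u k) (2 * a)) (pow (u k) (2 * b)) (pow (u k) (2 * c))
        (pow (u k) (2 * a + 2 * b)) (pow (u k) (2 * a + 2 * b + 2 * c)) (D k) (B k)
        (tSum (plain (3 + 2 * b + 2 * c) ∷ []) k) (tSum (bar (1 + 2 * c) ∷ []) k)
        (tSum (bar (2 + 2 * b) ∷ bar (1 + 2 * c) ∷ []) k)
        (term (bar (5 + 2 * a + 2 * b + 2 * c)) k) (term (bar (2 + 2 * a)) k) (term (plain (4 + 2 * a + 2 * b)) k)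
        (alt² k) (pow-+ (u k) (2 * a) (2 * b)) (pow-+-+ (u k) (2 * a) (2 * b) (2 * c)) (D≡ k) (B≡ k)
        (term-bar (5 + 2 * a + 2 * b + 2 * c) k) (term-bar (2 + 2 * a) k) (term-plain (4 + 2 * a + 2 * b) k))
    (∑-4-terms n (λ k → term (bar (5 + 2 * a + 2 * b + 2 * c)) k ⊛ 1ℚ)
      (λ k → term (bar (2 + 2 * a)) k ⊛ tSum (plain (3 + 2 * b + 2 * c) ∷ []) k)
      (λ k → term (plain (4 + 2 * a + 2 * b)) k ⊛ tSum (bar (1 + 2 * c) ∷ []) k)
      (λ k → term (bar (2 + 2 * a)) k ⊛ tSum (bar (2 + 2 * b) ∷ bar (1 + 2 * c) ∷ []) k))
    where
    algebra : ∀ s x pa pb pc pab pabc d B T₂ T₃ T₄ τ₁ τ₂ τ₃ →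
      s ⊛ s ≡ 1ℚ → pab ≡ pa ⊛ pb → pabc ≡ pa ⊛ pb ⊛ pc → d ≡ - 1ℚ ⊛ T₃ → B ≡ T₂ ⊕ 2ℚ ⊛ T₄ →
      τ₁ ≡ - (s ⊛ (x ⊛ (x ⊛ (x ⊛ (x ⊛ (x ⊛ pabc)))))) → τ₂ ≡ - (s ⊛ (x ⊛ (x ⊛ pa))) →
      τ₃ ≡ x ⊛ (x ⊛ (x ⊛ (x ⊛ pab))) →
      s ⊛ x ⊛ (pa ⊛ (x ⊛ (B ⊕ (B ⊕ x ⊛ x ⊛ (pb ⊛ (s ⊛ (d ⊕ (d ⊕ s ⊛ x ⊛ (pc ⊛ 1ℚ))))))))) ≡
      - (τ₁ ⊛ 1ℚ ⊕ 2ℚ ⊛ (τ₂ ⊛ T₂) ⊕ 2ℚ ⊛ (τ₃ ⊛ T₃) ⊕ 4ℚ ⊛ (τ₂ ⊛ T₄))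
    algebra s x pa pb pc pab pabc d B T₂ T₃ T₄ τ₁ τ₂ τ₃ h refl refl refl refl refl refl refl =
      modulo (x ⊛ x ⊛ x ⊛ x ⊛ pa ⊛ pb ⊛ (s ⊛ x ⊛ pc ⊝ 2ℚ ⊛ T₃)) h
      (solve 8 (λ s x pa pb pc T₂ T₃ T₄ → let d = con (- 1ℚ) :* T₃ ; B = T₂ :+ con 2ℚ :* T₄ ; τ₂ = ⊖ (s :* (x :* (x :* pa))) in
        s :* x :* (pa :* (x :* (B :+ (B :+ x :* x :* (pb :* (s :* (d :+ (d :+ s :* x :* (pc :* con 1ℚ))))))))) :=
        ⊖ ((⊖ (s :* (x :* (x :* (x :* (x :* (x :* (pa :* pb :* pc)))))))) :* con 1ℚ :+ con 2ℚ :* (τ₂ :* T₂)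
          :+ con 2ℚ :* (x :* (x :* (x :* (x :* (pa :* pb)))) :* T₃) :+ con 4ℚ :* (τ₂ :* T₄))
        :+ x :* x :* x :* x :* pa :* pb :* (s :* x :* pc :- con 2ℚ :* T₃) :* (s :* s :- con 1ℚ)) refl s x pa pb pc T₂ T₃ T₄)

module Expansion₃ (a b c : ℕ) where

  D U B Z : ℕ → ℚ
  D k = ∑ k (λ i → u i ⊛ u i ⊛ (pow (u i) (2 * c) ⊛ 1ℚ))
  U k = pow (u k) (2 * b) ⊛ (u k ⊛ (D k ⊕ D (suc k)))
  B k = ∑ k (λ i → u i ⊛ u i ⊛ U i)
  Z k = pow (u k) (2 * a) ⊛ (u k ⊛ (B k ⊕ B (suc k)))

  represents : Represents (replicate a 2 ++ 3 ∷ replicate b 2 ++ 3 ∷ replicate c 2) Z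
  represents = represents-2s a {3 ∷ replicate b 2 ++ 3 ∷ replicate c 2}
    (represents-3∷ {replicate b 2 ++ 3 ∷ replicate c 2}
    (represents-2s b {3 ∷ replicate c 2} (represents-3∷ {replicate c 2} (represents-final-2s c))))

  D≡ : ∀ k → D k ≡ tSum (plain (2 + 2 * c) ∷ []) k
  D≡ k = ∑-cong k λ i → algebra (u i) (pow (u i) (2 * c)) _ (term-plain (2 + 2 * c) i)
    where
    algebra : ∀ x p τ → τ ≡ x ⊛ (x ⊛ p) → x ⊛ x ⊛ (p ⊛ 1ℚ) ≡ τ ⊛ 1ℚ
    algebra x p τ refl = solve 2 (λ x p → x :* x :* (p :* con 1ℚ) := x :* (x :* p) :* con 1ℚ) refl x p

  B≡ : ∀ k → B k ≡ tSum (plain (5 + 2 * b + 2 * c) ∷ []) k ⊕ 2ℚ ⊛ tSum (plain (3 + 2 * b) ∷ plain (2 + 2 * c) ∷ []) k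
  B≡ k = trans (∑-cong k λ i → algebra (u i) (pow (u i) (2 * b)) (pow (u i) (2 * c))
        (pow (u i) (2 * b + 2 * c)) (D i) (tSum (plain (2 + 2 * c) ∷ []) i)
        (term (plain (5 + 2 * b + 2 * c)) i) (term (plain (3 + 2 * b)) i)
        (pow-+ (u i) (2 * b) (2 * c)) (D≡ i) (term-plain (5 + 2 * b + 2 * c) i) (term-plain (3 + 2 * b) i))
    (∑-2-terms k (λ i → term (plain (5 + 2 * b + 2 * c)) i ⊛ 1ℚ)
      (λ i → term (plain (3 + 2 * b)) i ⊛ tSum (plain (2 + 2 * c) ∷ []) i))
    where
    algebra : ∀ x pb pc pbc d T τ₁ τ₂ → pbc ≡ pb ⊛ pc → d ≡ T →
      τ₁ ≡ x ⊛ (x ⊛ (x ⊛ (x ⊛ (x ⊛ pbc)))) → τ₂ ≡ x ⊛ (x ⊛ (x ⊛ pb)) →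
      x ⊛ x ⊛ (pb ⊛ (x ⊛ (d ⊕ (d ⊕ x ⊛ x ⊛ (pc ⊛ 1ℚ))))) ≡ τ₁ ⊛ 1ℚ ⊕ 2ℚ ⊛ (τ₂ ⊛ T)
    algebra x pb pc pbc d T τ₁ τ₂ refl refl refl refl = solve 4 (λ x pb pc T →
        x :* x :* (pb :* (x :* (T :+ (T :+ x :* x :* (pc :* con 1ℚ))))) :=
        x :* (x :* (x :* (x :* (x :* (pb :* pc))))) :* con 1ℚ :+ con 2ℚ :* (x :* (x :* (x :* pb)) :* T)) refl x pb pc T

  -- The same four choices; only the outer `e k` carries a sign, so exactly the first entry is
  -- barred.
  sum≡ : ∀ n → ∑ n (λ k → e k ⊛ Z k) ≡
    - (tSum (bar (7 + 2 * a + 2 * b + 2 * c) ∷ []) n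
      ⊕ 2ℚ ⊛ tSum (bar (2 + 2 * a) ∷ plain (5 + 2 * b + 2 * c) ∷ []) n
      ⊕ 2ℚ ⊛ tSum (bar (5 + 2 * a + 2 * b) ∷ plain (2 + 2 * c) ∷ []) n
      ⊕ 4ℚ ⊛ tSum (bar (2 + 2 * a) ∷ plain (3 + 2 * b) ∷ plain (2 + 2 * c) ∷ []) n)
  sum≡ n = trans (∑-cong n λ k → algebra (alt k) (u k) (pow (u k) (2 * a)) (pow (u k) (2 * b)) (pow (u k) (2 * c))
        (pow (u k) (2 * a + 2 * b)) (pow (u k) (2 * a + 2 * b + 2 * c)) (D k) (B k)
        (tSum (plain (5 + 2 * b + 2 * c) ∷ []) k) (tSum (plain (2 + 2 * c) ∷ []) k)
        (tSum (plain (3 + 2 * b) ∷ plain (2 + 2 * c) ∷ []) k)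
        (term (bar (7 + 2 * a + 2 * b + 2 * c)) k) (term (bar (2 + 2 * a)) k) (term (bar (5 + 2 * a + 2 * b)) k)
        (pow-+ (u k) (2 * a) (2 * b)) (pow-+-+ (u k) (2 * a) (2 * b) (2 * c)) (D≡ k) (B≡ k)
        (term-bar (7 + 2 * a + 2 * b + 2 * c) k) (term-bar (2 + 2 * a) k) (term-bar (5 + 2 * a + 2 * b) k))
    (∑-4-terms n (λ k → term (bar (7 + 2 * a + 2 * b + 2 * c)) k ⊛ 1ℚ)
      (λ k → term (bar (2 + 2 * a)) k ⊛ tSum (plain (5 + 2 * b + 2 * c) ∷ []) k)
      (λ k → term (bar (5 + 2 * a + 2 * b)) k ⊛ tSum (plain (2 + 2 * c) ∷ []) k)
      (λ k → term (bar (2 + 2 * a)) k ⊛ tSum (plain (3 + 2 * b) ∷ plain (2 + 2 * c) ∷ []) k))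
    where
    algebra : ∀ s x pa pb pc pab pabc d B T₂ T₃ T₄ τ₁ τ₂ τ₃ →
      pab ≡ pa ⊛ pb → pabc ≡ pa ⊛ pb ⊛ pc → d ≡ T₃ → B ≡ T₂ ⊕ 2ℚ ⊛ T₄ →
      τ₁ ≡ - (s ⊛ (x ⊛ (x ⊛ (x ⊛ (x ⊛ (x ⊛ (x ⊛ (x ⊛ pabc)))))))) → τ₂ ≡ - (s ⊛ (x ⊛ (x ⊛ pa))) →
      τ₃ ≡ - (s ⊛ (x ⊛ (x ⊛ (x ⊛ (x ⊛ (x ⊛ pab)))))) →
      s ⊛ x ⊛ (pa ⊛ (x ⊛ (B ⊕ (B ⊕ x ⊛ x ⊛ (pb ⊛ (x ⊛ (d ⊕ (d ⊕ x ⊛ x ⊛ (pc ⊛ 1ℚ))))))))) ≡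
      - (τ₁ ⊛ 1ℚ ⊕ 2ℚ ⊛ (τ₂ ⊛ T₂) ⊕ 2ℚ ⊛ (τ₃ ⊛ T₃) ⊕ 4ℚ ⊛ (τ₂ ⊛ T₄))
    algebra s x pa pb pc pab pabc d B T₂ T₃ T₄ τ₁ τ₂ τ₃ refl refl refl refl refl refl refl =
      solve 8 (λ s x pa pb pc T₂ T₃ T₄ → let B = T₂ :+ con 2ℚ :* T₄ ; τ₂ = ⊖ (s :* (x :* (x :* pa))) in
        s :* x :* (pa :* (x :* (B :+ (B :+ x :* x :* (pb :* (x :* (T₃ :+ (T₃ :+ x :* x :* (pc :* con 1ℚ))))))))) :=
        ⊖ ((⊖ (s :* (x :* (x :* (x :* (x :* (x :* (x :* (x :* (pa :* pb :* pc)))))))))) :* con 1ℚ :+ con 2ℚ :* (τ₂ :* T₂)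
          :+ con 2ℚ :* ((⊖ (s :* (x :* (x :* (x :* (x :* (x :* (pa :* pb)))))))) :* T₃) :+ con 4ℚ :* (τ₂ :* T₄)))
        refl s x pa pb pc T₂ T₃ T₄

theorem4p5 : ∀ (a b c : ℕ) →
    (t⋆ (replicate a 2 ++ 3 ∷ replicate b 2 ++ 1 ∷ replicate c 2) (admissible-2-3-2-s-2 a b c (s≤s z≤n))
    ≃ᴿ -ᴿ (4 /π) *ᴿ t (bar (5 + 2 * a + 2 * b + 2 * c) ∷ []) admissible!
    -ᴿ 8 /π *ᴿ t (bar (2 + 2 * a) ∷ plain (3 + 2 * b + 2 * c) ∷ []) admissible!
    -ᴿ 8 /π *ᴿ t (plain (4 + 2 * a + 2 * b) ∷ bar (1 + 2 * c) ∷ []) admissible!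
    -ᴿ 16 /π *ᴿ t (bar (2 + 2 * a) ∷ bar (2 + 2 * b) ∷ bar (1 + 2 * c) ∷ []) admissible!)
    ×
    (t⋆ (replicate a 2 ++ 3 ∷ replicate b 2 ++ 3 ∷ replicate c 2) (admissible-2-3-2-s-2 a b c (s≤s z≤n))
    ≃ᴿ -ᴿ (4 /π) *ᴿ t (bar (7 + 2 * a + 2 * b + 2 * c) ∷ []) admissible!
    -ᴿ 8 /π *ᴿ t (bar (2 + 2 * a) ∷ plain (5 + 2 * b + 2 * c) ∷ []) admissible!
    -ᴿ 8 /π *ᴿ t (bar (5 + 2 * a + 2 * b) ∷ plain (2 + 2 * c) ∷ []) admissible!
    -ᴿ 16 /π *ᴿ t (bar (2 + 2 * a) ∷ plain (3 + 2 * b) ∷ plain (2 + 2 * c) ∷ []) admissible!)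
theorem4p5 a b c =
    4-term-limit (t⋆ (replicate a 2 ++ 3 ∷ replicate b 2 ++ 1 ∷ replicate c 2) (admissible-2-3-2-s-2 a b c (s≤s z≤n)))
      (t (bar (5 + 2 * a + 2 * b + 2 * c) ∷ []) admissible!)
      (t (bar (2 + 2 * a) ∷ plain (3 + 2 * b + 2 * c) ∷ []) admissible!)
      (t (plain (4 + 2 * a + 2 * b) ∷ bar (1 + 2 * c) ∷ []) admissible!)
      (t (bar (2 + 2 * a) ∷ bar (2 + 2 * b) ∷ bar (1 + 2 * c) ∷ []) admissible!)
      (Expansion₁.Z a b c) (Expansion₁.represents a b c) (Expansion₁.sum≡ a b c)
  , 4-term-limit (t⋆ (replicate a 2 ++ 3 ∷ replicate b 2 ++ 3 ∷ replicate c 2) (admissible-2-3-2-s-2 a b c (s≤s z≤n)))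
      (t (bar (7 + 2 * a + 2 * b + 2 * c) ∷ []) admissible!)
      (t (bar (2 + 2 * a) ∷ plain (5 + 2 * b + 2 * c) ∷ []) admissible!)
      (t (bar (5 + 2 * a + 2 * b) ∷ plain (2 + 2 * c) ∷ []) admissible!)
      (t (bar (2 + 2 * a) ∷ plain (3 + 2 * b) ∷ plain (2 + 2 * c) ∷ []) admissible!)
      (Expansion₃.Z a b c) (Expansion₃.represents a b c) (Expansion₃.sum≡ a b c)
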